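{- $\pi_{5.1}(\emptyset)=\pi_{5.9}(\emptyset)=\dfrac{5}{8}$.
   Context: A $3$-graph is a pair $G=(V,E)$ with $E$ a set of $3$-element subsets of $V$. For integers $m,k$, $m.k$ denotes the family of all $3$-graphs on $m$ vertices with exactly $k$ edges (so $5.9$ consists of the $3$-graph obtained from the complete $3$-graph on $5$ vertices by deleting one edge). For a $3$-graph $G$ on $n\ge m$ vertices, $e_{m.k}(G)$ is the number of $m$-element subsets of $V(G)$ spanning exactly $k$ edges of $G$, and $\pi_{m.k}(\emptyset)=\lim_{n\to\infty}\max\{e_{m.k}(G): |V(G)|=n\}/\binom{n}{m}$ (the limit exists). -}

module Defs where

open import Data.Bool using (Bool; true; false; _∧_; not; if_then_else_)
open import Data.Nat using (ℕ; zero; suc; _≡ᵇ_)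
open import Data.List using (List; []; _∷_; map; _++_; filterᵇ; length)
open import Data.Vec using (Vec; []; _∷_)
open import Data.Fin.Subset using (Subset; ∣_∣)

subsets : (n : ℕ) → List (Subset n)
subsets zero = [] ∷ []
subsets (suc n) = map (false ∷_) (subsets n) ++ map (true ∷_) (subsets n)

_⊆ᵇ_ : ∀ {n} → Subset n → Subset n → Bool
[] ⊆ᵇ [] = true
(false ∷ p) ⊆ᵇ (_ ∷ q) = p ⊆ᵇ q
(true ∷ p) ⊆ᵇ (b ∷ q) = b ∧ (p ⊆ᵇ q)

-- A 3-graph on vertex set Fin n: its edge set is the set of 3-element
-- subsets T of Fin n with isEdge T ≡ true (values on subsets of size ≠ 3
-- are irrelevant).
record ThreeGraph (n : ℕ) : Set where
  field
    isEdge : Subset n → Bool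
open ThreeGraph public

edgeᵇ : ∀ {n} → ThreeGraph n → Subset n → Bool
edgeᵇ G T = (∣ T ∣ ≡ᵇ 3) ∧ isEdge G T

edgesIn : ∀ {n} → ThreeGraph n → Subset n → ℕ
edgesIn {n} G S = length (filterᵇ (λ T → edgeᵇ G T ∧ (T ⊆ᵇ S)) (subsets n))

e[_∙_] : (m k : ℕ) → ∀ {n} → ThreeGraph n → ℕ
e[ m ∙ k ] {n} G =
  length (filterᵇ (λ S → (∣ S ∣ ≡ᵇ m) ∧ (edgesIn G S ≡ᵇ k)) (subsets n))

{-# OPTIONS --safe #-}
module Submission where

-- Sampling vertices with repetition makes averages of squares exactly non-negative.  For a sampled 6-tuple, 48 times
-- the number of its 5-subsets with exactly one edge plus a suitable weighted sum of squares (over flags on 4 or 2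
-- labelled vertices) is at most 180 on every 3-graph on 6 labelled vertices; this finite statement is checked by
-- branching on the 20 edges.  Hence the density of 5-tuples with exactly one edge is at most 180 / (6 · 48) = 5/8.
-- Tuples without repetition account for all but O(n⁴) samples.  The bound is attained by the union of two
-- complete 3-graphs on n/2 vertices, where the one-edge 5-sets are those that split 3 + 2, with density
-- 20/32.  Complementing edges exchanges "exactly one" and "exactly nine".

open import Defs

-- The 6-vertex inequality holds at every assignment of the 20 edge variables, so a sample that
-- repeats a vertex needs no separate treatment: it merely produces one more assignment. A single
-- labelled square is tied to one placement of the labels, whereas a pointwise bound has to be
-- symmetric. Summing over arrangements of the labels reconciles the two, since it only multiplies
-- the sum over all samples by the number of arrangements.
--
-- The bipartition dictates the data. With equal parts it has density exactly 5/8 and every square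
-- averages to zero, so there is no slack on it: each of its 6-vertex patterns 6+0, 5+1, 4+2 and 3+3
-- must give exactly 180. The factor 48 is the least common denominator of the weights 1/4, 11/48,
-- 1/48, 1/4, 2/3 and 1/6 that belong to an objective with coefficient 1.
--
-- The obstacle is the cost of examining all assignments of 20 variables. Hence the early cut-off by
-- a crude bound, the order of the variables, and the restriction to one arrangement per symmetry
-- class.

module TupleSums where

  open import Data.Bool using (Bool; true; false; _∧_; not; if_then_else_; T)
  open import Data.Fin using (Fin; zero; suc; toℕ)
  import Data.Fin.Properties as Fin
  open import Data.Integer using (ℤ; +_; -[1+_]; 0ℤ; 1ℤ; _+_; _*_; _≤_; +≤+; _≤ᵇ_)
  open import Data.Integer.Properties
    using (+-*-semiring; +-mono-≤; ≤-refl; ≤-trans; ≤-reflexive; +-identityˡ;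
           *-identityˡ; *-zeroˡ; *-zeroʳ; *-identityʳ; *-distribʳ-+; *-assoc; *-comm; +-assoc; ≤ᵇ⇒≤; pos-*;
           *-monoˡ-≤-nonNeg)
  open import Data.Integer.Tactic.RingSolver using (solve-∀)
  open import Data.List using (List; []; _∷_; _++_; map; concatMap; filterᵇ)
  open import Data.Bool.ListAction using (all)
  open import Data.Nat using (ℕ; zero; suc; _≡ᵇ_; _<ᵇ_; _/_; z≤n) renaming (_+_ to _+ℕ_; _*_ to _*ℕ_; _^_ to _^ℕ_)
  open import Data.Nat.DivMod using (_mod_)
  import Data.Nat.Properties as ℕ
  open import Data.Product using (_×_; _,_; proj₁; proj₂; map₁)
  open import Data.Vec using (Vec; []; _∷_; lookup; insertAt; allFin) renaming (_++_ to _++ᵛ_; map to mapᵛ)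
  open import Data.Vec.Properties using (map-insertAt; map-lookup-allFin; lookup-map)
  open import Algebra.Properties.Semiring.Sum +-*-semiring using (sum; sum-cong-≗; ∑-distrib-+; ∑-comm; *-distribˡ-sum)
  open import Function using (_∘_)
  open import Relation.Binary.PropositionalEquality
  open import Relation.Nullary.Decidable using (from-yes)
  open import Data.Product.Properties using (≡-dec)

  -- Sums over tuples

  sum-mono : ∀ {n} {f g : Fin n → ℤ} → (∀ i → f i ≤ g i) → sum f ≤ sum g
  sum-mono {zero}  f≤g = ≤-refl
  sum-mono {suc n} f≤g = +-mono-≤ (f≤g zero) (sum-mono (f≤g ∘ suc))

  sum-const : ∀ n c → sum {n} (λ _ → c) ≡ + n * c
  sum-const zero    c = sym (*-zeroˡ c)
  sum-const (suc n) c = trans (cong (_+_ c) (sum-const n c)) (eq c (+ n))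
    where
    eq : ∀ c m → c + m * c ≡ (1ℤ + m) * c
    eq = solve-∀

  module _ {n : ℕ} where

    ∑ᵛ : ∀ k → (Vec (Fin n) k → ℤ) → ℤ
    ∑ᵛ zero    h = h []
    ∑ᵛ (suc k) h = sum λ i → ∑ᵛ k λ v → h (i ∷ v)

    ∑ᵛ-cong : ∀ k {g h : Vec (Fin n) k → ℤ} → (∀ v → g v ≡ h v) → ∑ᵛ k g ≡ ∑ᵛ k h
    ∑ᵛ-cong zero    g≗h = g≗h []
    ∑ᵛ-cong (suc k) g≗h = sum-cong-≗ λ i → ∑ᵛ-cong k λ v → g≗h (i ∷ v)

    ∑ᵛ-mono : ∀ k {g h : Vec (Fin n) k → ℤ} → (∀ v → g v ≤ h v) → ∑ᵛ k g ≤ ∑ᵛ k h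
    ∑ᵛ-mono zero    g≤h = g≤h []
    ∑ᵛ-mono (suc k) g≤h = sum-mono λ i → ∑ᵛ-mono k λ v → g≤h (i ∷ v)

    ∑ᵛ-+ : ∀ k (g h : Vec (Fin n) k → ℤ) → ∑ᵛ k (λ v → g v + h v) ≡ ∑ᵛ k g + ∑ᵛ k h
    ∑ᵛ-+ zero    g h = refl
    ∑ᵛ-+ (suc k) g h = trans (sum-cong-≗ λ i → ∑ᵛ-+ k (g ∘ (i ∷_)) (h ∘ (i ∷_))) (∑-distrib-+ {n} _ _)

    ∑ᵛ-* : ∀ k c (h : Vec (Fin n) k → ℤ) → ∑ᵛ k (λ v → c * h v) ≡ c * ∑ᵛ k h
    ∑ᵛ-* zero    c h = refl
    ∑ᵛ-* (suc k) c h = trans (sum-cong-≗ λ i → ∑ᵛ-* k c (h ∘ (i ∷_))) (sym (*-distribˡ-sum {n} c _))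

    ∑ᵛ-const : ∀ k c → ∑ᵛ k (λ _ → c) ≡ + (n ^ℕ k) * c
    ∑ᵛ-const zero    c = sym (*-identityˡ c)
    ∑ᵛ-const (suc k) c = begin
      sum {n} (λ _ → ∑ᵛ k (λ _ → c))  ≡⟨ sum-const n _ ⟩
      + n * ∑ᵛ k (λ _ → c)            ≡⟨ cong (+ n *_) (∑ᵛ-const k c) ⟩
      + n * (+ (n ^ℕ k) * c)          ≡⟨ *-assoc (+ n) _ c ⟨
      + n * + (n ^ℕ k) * c            ≡⟨ cong (_* c) (pos-* n (n ^ℕ k)) ⟨
      + (n *ℕ n ^ℕ k) * c             ∎
      where open ≡-Reasoning

    ∑ᵛ-++ : ∀ k {l} (h : Vec (Fin n) (k +ℕ l) → ℤ) → ∑ᵛ (k +ℕ l) h ≡ ∑ᵛ k λ v → ∑ᵛ l λ w → h (v ++ᵛ w)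
    ∑ᵛ-++ zero    h = refl
    ∑ᵛ-++ (suc k) h = sum-cong-≗ λ i → ∑ᵛ-++ k (h ∘ (i ∷_))

    sum-∑ᵛ-comm : ∀ {m} k (h : Fin m → Vec (Fin n) k → ℤ) →
                  sum (λ i → ∑ᵛ k (h i)) ≡ ∑ᵛ k λ v → sum λ i → h i v
    sum-∑ᵛ-comm zero    h = refl
    sum-∑ᵛ-comm (suc k) h =
      trans (∑-comm λ i j → ∑ᵛ k λ v → h i (j ∷ v)) (sum-cong-≗ λ j → sum-∑ᵛ-comm k λ i → h i ∘ (j ∷_))

    ∑ᵛ-insertAt : ∀ k (c : Fin (suc k)) (h : Vec (Fin n) (suc k) → ℤ) →
                  ∑ᵛ k (λ v → sum λ x → h (insertAt v c x)) ≡ ∑ᵛ (suc k) h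
    ∑ᵛ-insertAt k       zero    h = sym (sum-∑ᵛ-comm k λ x v → h (x ∷ v))
    ∑ᵛ-insertAt (suc k) (suc c) h = sum-cong-≗ λ y → ∑ᵛ-insertAt k c (h ∘ (y ∷_))

    ∑ᵛ-square : ∀ k (h : Vec (Fin n) k → ℤ) → ∑ᵛ k (λ v → ∑ᵛ k λ w → h v * h w) ≡ ∑ᵛ k h * ∑ᵛ k h
    ∑ᵛ-square k h = begin
      ∑ᵛ k (λ v → ∑ᵛ k λ w → h v * h w)  ≡⟨ ∑ᵛ-cong k (λ v → trans (∑ᵛ-* k (h v) h) (*-comm (h v) _)) ⟩
      ∑ᵛ k (λ v → ∑ᵛ k h * h v)          ≡⟨ ∑ᵛ-* k (∑ᵛ k h) h ⟩
      ∑ᵛ k h * ∑ᵛ k h                    ∎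
      where open ≡-Reasoning

  -- Permutations

  -- Lehmer codes of the permutations of k points.
  data Code : ℕ → Set where
    []  : Code 0
    _∷_ : ∀ {k} → Fin (suc k) → Code k → Code (suc k)

  act : ∀ {A : Set} {k} → Code k → Vec A k → Vec A k
  act []       []       = []
  act (c ∷ cs) (x ∷ xs) = insertAt (act cs xs) c x

  -- Each digit of a code inserts one coordinate, and an insertion only reorders iterated sums.
  -- Invariance under permutations therefore follows by induction on the code, without constructing
  -- a bijection of tuples.
  ∑ᵛ-act : ∀ {n k} (cs : Code k) (h : Vec (Fin n) k → ℤ) → ∑ᵛ k (h ∘ act cs) ≡ ∑ᵛ k h
  ∑ᵛ-act []                   h = refl
  ∑ᵛ-act {k = suc k} (c ∷ cs) h = begin
    sum (λ x → ∑ᵛ k λ v → h (insertAt (act cs v) c x))  ≡⟨ sum-∑ᵛ-comm k (λ x v → h (insertAt (act cs v) c x)) ⟩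
    ∑ᵛ k (λ v → sum λ x → h (insertAt (act cs v) c x))  ≡⟨ ∑ᵛ-act cs (λ w → sum λ x → h (insertAt w c x)) ⟩
    ∑ᵛ k (λ w → sum λ x → h (insertAt w c x))           ≡⟨ ∑ᵛ-insertAt k c h ⟩
    ∑ᵛ (suc k) h                                        ∎
    where open ≡-Reasoning

  act-map : ∀ {A B : Set} {k} (f : A → B) (cs : Code k) (v : Vec A k) → act cs (mapᵛ f v) ≡ mapᵛ f (act cs v)
  act-map f []       []      = refl
  act-map f (c ∷ cs) (x ∷ v) =
    trans (cong (λ w → insertAt w c (f x)) (act-map f cs v)) (sym (map-insertAt f x (act cs v) c))

  position : ∀ {k} → Code k → Fin k → Fin k
  position cs = lookup (act cs (allFin _))

  lookup-act : ∀ {A : Set} {k} (cs : Code k) (v : Vec A k) i → lookup (act cs v) i ≡ lookup v (position cs i)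
  lookup-act cs v i = begin
    lookup (act cs v) i                           ≡⟨ cong (λ w → lookup (act cs w) i) (map-lookup-allFin v) ⟨
    lookup (act cs (mapᵛ (lookup v) (allFin _))) i ≡⟨ cong (λ w → lookup w i) (act-map (lookup v) cs (allFin _)) ⟩
    lookup (mapᵛ (lookup v) (act cs (allFin _))) i ≡⟨ lookup-map i (lookup v) (act cs (allFin _)) ⟩
    lookup v (position cs i)                      ∎
    where open ≡-Reasoning

  codes : ∀ k → List (Code k)
  codes zero    = [] ∷ []
  codes (suc k) = concatMap (λ cs → map (_∷ cs) (Data.List.allFin (suc k))) (codes k)

  arrangements : ∀ {k} → List (Fin k × Fin k) → List (Code k)
  arrangements lts = filterᵇ (λ cs → all (λ (i , j) → toℕ (position cs i) <ᵇ toℕ (position cs j)) lts) (codes _)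

  -- Polynomials in the edge indicators

  Literal : Set → Set
  Literal L = (L × L × L) × Bool

  Poly : Set → Set
  Poly L = List (ℤ × List (Literal L))

  renameₗ : ∀ {L M} → (L → M) → Literal L → Literal M
  renameₗ f ((i , j , k) , b) = (f i , f j , f k) , b

  rename : ∀ {L M} → (L → M) → Poly L → Poly M
  rename f = map λ (c , m) → c , map (renameₗ f) m

  infixl 7 _⊗_
  _⊗_ : ∀ {L} → Poly L → Poly L → Poly L
  p ⊗ q = concatMap (λ (c , m) → map (λ (d , m′) → c * d , m ++ m′) q) p

  𝟙 : Bool → ℤ
  𝟙 b = if b then 1ℤ else 0ℤ

  _≟ᵇ_ : Bool → Bool → Bool
  true  ≟ᵇ b = b
  false ≟ᵇ b = not b

  module Evaluation {A : Set} (E : A → A → A → Bool) where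

    edge : ∀ {L : Set} → (L → A) → L × L × L → Bool
    edge ρ (i , j , k) = E (ρ i) (ρ j) (ρ k)

    monomial : ∀ {L} → (L → A) → List (Literal L) → ℤ
    monomial ρ []             = 1ℤ
    monomial ρ ((t , b) ∷ ls) = 𝟙 (b ≟ᵇ edge ρ t) * monomial ρ ls

    ev : ∀ {L} → (L → A) → Poly L → ℤ
    ev ρ []            = 0ℤ
    ev ρ ((c , m) ∷ p) = c * monomial ρ m + ev ρ p

    module _ {L : Set} (ρ : L → A) where

      monomial-++ : ∀ m m′ → monomial ρ (m ++ m′) ≡ monomial ρ m * monomial ρ m′
      monomial-++ []             m′ = sym (*-identityˡ _)
      monomial-++ ((t , b) ∷ ls) m′ = trans (cong (𝟙 (b ≟ᵇ edge ρ t) *_) (monomial-++ ls m′)) (sym (*-assoc (𝟙 (b ≟ᵇ edge ρ t)) _ _))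

      0≤monomial : ∀ m → 0ℤ ≤ monomial ρ m
      0≤monomial []             = +≤+ z≤n
      0≤monomial ((t , b) ∷ ls) with b ≟ᵇ edge ρ t
      ... | true  = ≤-trans (0≤monomial ls) (≤-reflexive (sym (*-identityˡ _)))
      ... | false = ≤-reflexive (sym (*-zeroˡ (monomial ρ ls)))

      ev-++ : ∀ p q → ev ρ (p ++ q) ≡ ev ρ p + ev ρ q
      ev-++ []            q = sym (+-identityˡ _)
      ev-++ ((c , m) ∷ p) q = trans (cong (_+_ (c * monomial ρ m)) (ev-++ p q)) (sym (+-assoc (c * monomial ρ m) _ _))

      ev-⊗ : ∀ p q → ev ρ (p ⊗ q) ≡ ev ρ p * ev ρ q
      ev-⊗ []            q = sym (*-zeroˡ (ev ρ q))
      ev-⊗ ((c , m) ∷ p) q = begin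
        ev ρ (scaled q ++ p ⊗ q)                   ≡⟨ ev-++ (scaled q) (p ⊗ q) ⟩
        ev ρ (scaled q) + ev ρ (p ⊗ q)             ≡⟨ cong₂ _+_ (ev-scaled q) (ev-⊗ p q) ⟩
        c * monomial ρ m * ev ρ q + ev ρ p * ev ρ q    ≡⟨ *-distribʳ-+ (ev ρ q) (c * monomial ρ m) (ev ρ p) ⟨
        (c * monomial ρ m + ev ρ p) * ev ρ q           ∎
        where
        open ≡-Reasoning
        scaled : Poly L → Poly L
        scaled = map λ (d , m′) → c * d , m ++ m′
        eq : ∀ c d x y z → c * d * (x * y) + c * x * z ≡ c * x * (d * y + z)
        eq = solve-∀
        ev-scaled : ∀ q → ev ρ (scaled q) ≡ c * monomial ρ m * ev ρ q
        ev-scaled []             = sym (*-zeroʳ (c * monomial ρ m))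
        ev-scaled ((d , m′) ∷ q) = begin
          c * d * monomial ρ (m ++ m′) + ev ρ (scaled q)              ≡⟨ cong₂ (λ x y → c * d * x + y) (monomial-++ m m′) (ev-scaled q) ⟩
          c * d * (monomial ρ m * monomial ρ m′) + c * monomial ρ m * ev ρ q  ≡⟨ eq c d (monomial ρ m) (monomial ρ m′) (ev ρ q) ⟩
          c * monomial ρ m * (d * monomial ρ m′ + ev ρ q)                 ∎

    module _ {L M : Set} {f : L → M} {ρ : L → A} {σ : M → A} (ρ≗σ∘f : ∀ i → ρ i ≡ σ (f i)) where

      monomial-rename : ∀ m → monomial σ (map (renameₗ f) m) ≡ monomial ρ m
      monomial-rename []                         = refl
      monomial-rename (((i , j , k) , b) ∷ ls)
        rewrite ρ≗σ∘f i | ρ≗σ∘f j | ρ≗σ∘f k = cong (𝟙 (b ≟ᵇ edge σ (f i , f j , f k)) *_) (monomial-rename ls)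

      ev-rename : ∀ p → ev σ (rename f p) ≡ ev ρ p
      ev-rename []            = refl
      ev-rename ((c , m) ∷ p) = cong₂ (λ x y → c * x + y) (monomial-rename m) (ev-rename p)

  -- Upper bounds by branching on the values of the variables

  Term : Set
  Term = ℤ × List (ℕ × Bool)

  -- A product of literals lies between 0 and 1, so a term with open literals is at most the
  -- positive part of its coefficient. Once all its literals are settled, the coefficient counts
  -- with its sign; this is how the bound sharpens along a branch.
  upper : Term → ℤ
  upper (c , [])            = c
  upper (+ c , _ ∷ _)       = + c
  upper (-[1+ c ] , _ ∷ _)  = 0ℤ

  total : List Term → ℤ
  total []       = 0ℤ
  total (t ∷ ts) = upper t + total ts

  -- Only leading literals are inspected, which loses nothing when literals are sorted in branching order.
  restrict : ℕ → Bool → List Term → List Term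
  restrict x b []                          = []
  restrict x b ((c , []) ∷ ts)             = (c , []) ∷ restrict x b ts
  restrict x b ((c , (y , d) ∷ ls) ∷ ts)   =
    if x ≡ᵇ y then (if d ≟ᵇ b then (c , ls) ∷ restrict x b ts else restrict x b ts)
    else (c , (y , d) ∷ ls) ∷ restrict x b ts

  bounded : ℤ → List ℕ → List Term → Bool
  branch  : ℤ → List ℕ → List Term → Bool
  bounded B xs ts = if total ts ≤ᵇ B then true else branch B xs ts
  branch B []       ts = false
  branch B (x ∷ xs) ts = bounded B xs (restrict x true ts) ∧ bounded B xs (restrict x false ts)

  sortLiterals : List (ℕ × Bool) → List (ℕ × Bool)
  insertLiteral : ℕ × Bool → List (ℕ × Bool) → List (ℕ × Bool)
  insertLiteral l []       = l ∷ []
  insertLiteral l (k ∷ ks) = if proj₁ l <ᵇ proj₁ k then l ∷ k ∷ ks else k ∷ insertLiteral l ks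
  sortLiterals []       = []
  sortLiterals (l ∷ ls) = insertLiteral l (sortLiterals ls)

  module Assignment (σ : ℕ → Bool) where

    clause : List (ℕ × Bool) → ℤ
    clause []             = 1ℤ
    clause ((x , d) ∷ ls) = 𝟙 (d ≟ᵇ σ x) * clause ls

    value : List Term → ℤ
    value []            = 0ℤ
    value ((c , m) ∷ p) = c * clause m + value p

    0≤clause≤1 : ∀ m → (0ℤ ≤ clause m) × (clause m ≤ 1ℤ)
    0≤clause≤1 []             = +≤+ z≤n , ≤-refl
    0≤clause≤1 ((x , d) ∷ ls) with d ≟ᵇ σ x
    ... | true  = subst (λ z → (0ℤ ≤ z) × (z ≤ 1ℤ)) (sym (*-identityˡ _)) (0≤clause≤1 ls)
    ... | false rewrite *-zeroˡ (clause ls) = ≤-refl , +≤+ z≤n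

    *clause≤upper : ∀ t → proj₁ t * clause (proj₂ t) ≤ upper t
    *clause≤upper (c , [])                = ≤-reflexive (*-identityʳ c)
    *clause≤upper (+ c , m@(_ ∷ _))       =
      ≤-trans (*-monoˡ-≤-nonNeg (+ c) (proj₂ (0≤clause≤1 m))) (≤-reflexive (*-identityʳ (+ c)))
    *clause≤upper (-[1+ c ] , m@(_ ∷ _))  =
      ≤-trans (*-monoˡ-≤-nonPos -[1+ c ] (proj₁ (0≤clause≤1 m))) (≤-reflexive (*-zeroʳ -[1+ c ]))
      where open Data.Integer.Properties using (*-monoˡ-≤-nonPos)

    value≤total : ∀ ts → value ts ≤ total ts
    value≤total []       = ≤-refl
    value≤total (t ∷ ts) = +-mono-≤ (*clause≤upper t) (value≤total ts)

    value-restrict : ∀ x ts → value ts ≡ value (restrict x (σ x) ts)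
    value-restrict x []                        = refl
    value-restrict x ((c , []) ∷ ts)           = cong (_+_ (c * 1ℤ)) (value-restrict x ts)
    value-restrict x ((c , (y , d) ∷ ls) ∷ ts) with x ≡ᵇ y in x≡ᵇy
    ... | false = cong (_+_ (c * clause ((y , d) ∷ ls))) (value-restrict x ts)
    ... | true  with refl ← ℕ.≡ᵇ⇒≡ x y (subst T (sym x≡ᵇy) _) with d ≟ᵇ σ x
    ...   | true  = cong₂ (λ u v → c * u + v) (*-identityˡ _) (value-restrict x ts)
    ...   | false rewrite *-zeroˡ (clause ls) | *-zeroʳ c = trans (+-identityˡ _) (value-restrict x ts)

    -- The induction follows only the branch that agrees with `σ` on the current variable, where
    -- restricting leaves the value unchanged.
    bounded⇒≤ : ∀ B xs ts → bounded B xs ts ≡ true → value ts ≤ B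
    bounded⇒≤ B xs ts ok with total ts ≤ᵇ B in le
    bounded⇒≤ B xs       ts ok | true  = ≤-trans (value≤total ts) (≤ᵇ⇒≤ (subst T (sym le) _))
    bounded⇒≤ B (x ∷ xs) ts ok | false with bounded B xs (restrict x true ts) in okᵗ | σ x in σx
    ... | true | true  = subst (_≤ B) (sym (trans (value-restrict x ts) (cong (λ b → value (restrict x b ts)) σx))) (bounded⇒≤ B xs _ okᵗ)
    ... | true | false = subst (_≤ B) (sym (trans (value-restrict x ts) (cong (λ b → value (restrict x b ts)) σx))) (bounded⇒≤ B xs _ ok)

    clause-insert : ∀ l m → clause (insertLiteral l m) ≡ clause (l ∷ m)
    clause-insert l []      = refl
    clause-insert l (k ∷ m) with proj₁ l <ᵇ proj₁ k
    ... | true  = refl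
    ... | false = trans (cong (a *_) (clause-insert l m)) (eq a b (clause m))
      where
      a = 𝟙 (proj₂ k ≟ᵇ σ (proj₁ k))
      b = 𝟙 (proj₂ l ≟ᵇ σ (proj₁ l))
      eq : ∀ a b c → a * (b * c) ≡ b * (a * c)
      eq = solve-∀

    clause-sort : ∀ m → clause (sortLiterals m) ≡ clause m
    clause-sort []             = refl
    clause-sort ((x , d) ∷ ls) = trans (clause-insert (x , d) (sortLiterals ls)) (cong (𝟙 (d ≟ᵇ σ x) *_) (clause-sort ls))

  -- Variables: the triples of labels up to order

  Triple : Set
  Triple = Fin 6 × Fin 6 × Fin 6

  order₁₂ order₂₃ sort₃ : Triple → Triple
  order₁₂ (i , j , k) = if toℕ j <ᵇ toℕ i then (j , i , k) else (i , j , k)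
  order₂₃ (i , j , k) = if toℕ k <ᵇ toℕ j then (i , k , j) else (i , j , k)
  sort₃ = order₁₂ ∘ order₂₃ ∘ order₁₂

  -- Base 6 with the last entry most significant, so on sorted triples the numerical order is the
  -- colexicographic one.
  encode : Triple → ℕ
  encode (i , j , k) = toℕ i +ℕ 6 *ℕ (toℕ j +ℕ 6 *ℕ toℕ k)

  decode : ℕ → Triple
  decode x = x mod 6 , (x / 6) mod 6 , (x / 36) mod 6

  decode-encode : ∀ i j k → decode (encode (i , j , k)) ≡ (i , j , k)
  decode-encode = from-yes (Fin.all? λ i → Fin.all? λ j → Fin.all? λ k →
    ≡-dec Fin._≟_ (≡-dec Fin._≟_ Fin._≟_) (decode (encode (i , j , k))) (i , j , k))

  toTerms : Poly (Fin 6) → List Term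
  toTerms = map λ (c , m) → c , sortLiterals (map (map₁ (encode ∘ sort₃)) m)

  module Symmetric {n : ℕ} (E : Fin n → Fin n → Fin n → Bool)
                   (E-swap₁₂ : ∀ x y z → E x y z ≡ E y x z) (E-swap₂₃ : ∀ x y z → E x y z ≡ E x z y) where
    open Evaluation E

    module _ (ρ : Fin 6 → Fin n) where
      open Assignment (edge ρ ∘ decode)

      edge-order₁₂ : ∀ t → edge ρ (order₁₂ t) ≡ edge ρ t
      edge-order₁₂ (i , j , k) with toℕ j <ᵇ toℕ i
      ... | true  = E-swap₁₂ _ _ _
      ... | false = refl

      edge-order₂₃ : ∀ t → edge ρ (order₂₃ t) ≡ edge ρ t
      edge-order₂₃ (i , j , k) with toℕ k <ᵇ toℕ j
      ... | true  = E-swap₂₃ _ _ _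
      ... | false = refl

      edge-sort₃ : ∀ t → edge ρ (sort₃ t) ≡ edge ρ t
      edge-sort₃ t = trans (edge-order₁₂ (order₂₃ (order₁₂ t))) (trans (edge-order₂₃ (order₁₂ t)) (edge-order₁₂ t))

      edge-encode : ∀ t → edge ρ (decode (encode (sort₃ t))) ≡ edge ρ t
      edge-encode t = trans (cong (edge ρ) (decode-encode _ _ _)) (edge-sort₃ t)

      clause-encode : ∀ m → clause (map (map₁ (encode ∘ sort₃)) m) ≡ monomial ρ m
      clause-encode []             = refl
      clause-encode ((t , b) ∷ ls) = cong₂ (λ e z → 𝟙 (b ≟ᵇ e) * z) (edge-encode t) (clause-encode ls)

      value-toTerms : ∀ p → value (toTerms p) ≡ ev ρ p
      value-toTerms []            = refl
      value-toTerms ((c , m) ∷ p) =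
        cong₂ (λ x y → c * x + y) (trans (clause-sort (map (map₁ (encode ∘ sort₃)) m)) (clause-encode m)) (value-toTerms p)

      ev≤ : ∀ B p xs → bounded B xs (toTerms p) ≡ true → ev ρ p ≤ B
      ev≤ B p xs ok = subst (_≤ B) (value-toTerms p) (bounded⇒≤ B xs (toTerms p) ok)

open TupleSums

-- The certificate of squares and the bound for sampled tuples

module Certificate where

  open import Data.Bool using (Bool; true; false; not; if_then_else_)
  open import Data.Fin using (Fin; zero; suc; _↑ˡ_; _↑ʳ_)
  open import Data.Fin.Patterns using (0F; 1F; 2F; 3F; 4F; 5F)
  open import Data.Integer using (ℤ; +_; -[1+_]; 0ℤ; 1ℤ; -1ℤ; _+_; _*_; _≤_; +≤+)
  open import Data.List using (List; []; _∷_; _++_; map; concatMap; length; zipWith)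
  open import Data.Nat using (ℕ; zero; suc; _≡ᵇ_) renaming (_+_ to _+ℕ_; _^_ to _^ℕ_)
  open import Data.Product using (_×_; _,_)
  open import Data.Sum using (_⊎_; inj₁; inj₂; [_,_]′)
  open import Relation.Binary.PropositionalEquality
  open import Data.Vec using (Vec; lookup; []; _∷_) renaming (_++_ to _++ᵛ_)
  open import Data.Integer.Properties
    using (≤-reflexive; ≤-refl; ≤-trans; +-identityˡ; +-identityʳ; +-monoʳ-≤;
           +-mono-≤; *-identityˡ; *-identityʳ; *-zeroˡ; *-zeroʳ; pos-*; *-cancelˡ-≤-pos;
           module ≤-Reasoning)
  open import Data.Integer.Tactic.RingSolver using (solve-∀)
  import Data.Nat as ℕ
  open import Data.Vec.Properties using (lookup-++ˡ; lookup-++ʳ)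

  embed₁ embed₂ : ∀ s r → Fin s ⊎ Fin r → Fin (s +ℕ (r +ℕ r))
  embed₁ s r = [ _↑ˡ (r +ℕ r) , (λ i → s ↑ʳ (i ↑ˡ r)) ]′
  embed₂ s r = [ _↑ˡ (r +ℕ r) , (λ i → s ↑ʳ (r ↑ʳ i)) ]′

  -- The vertices inj₁ i are shared by both factors, the flag vertices inj₂ i are sampled twice.
  square : ∀ s r → ℕ → List (Literal (Fin s)) → Poly (Fin s ⊎ Fin r) → Poly (Fin (s +ℕ (r +ℕ r)))
  square s r w τ φ = ((+ w , map (renameₗ (_↑ˡ (r +ℕ r))) τ) ∷ []) ⊗ (rename (embed₁ s r) φ ⊗ rename (embed₂ s r) φ)

  orbit : ∀ {k} → List (Code k) → Poly (Fin k) → Poly (Fin k)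
  orbit css p = concatMap (λ cs → rename (position cs) p) css

  type₄ : Bool → Bool → Bool → Bool → List (Literal (Fin 4))
  type₄ a b c d = ((0F , 1F , 2F) , a) ∷ ((0F , 1F , 3F) , b) ∷ ((0F , 2F , 3F) , c) ∷ ((1F , 2F , 3F) , d) ∷ []

  -- The link of the flag vertex on the pairs 01, 02, 03, 12, 13, 23.
  link : List Bool → List (Literal (Fin 4 ⊎ Fin 1))
  link = zipWith (λ (i , j) b → (inj₁ i , inj₁ j , inj₂ 0F) , b)
    ((0F , 1F) ∷ (0F , 2F) ∷ (0F , 3F) ∷ (1F , 2F) ∷ (1F , 3F) ∷ (2F , 3F) ∷ [])

  pattern I = true
  pattern O = false

  none : List Bool
  none = O ∷ O ∷ O ∷ O ∷ O ∷ O ∷ []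

  -- The pairs (i , j) ask for i to be placed before j; they select one arrangement per symmetry class of the square.
  data Square : ℕ → Set where
    sq : ∀ s r → List (Fin (s +ℕ (r +ℕ r)) × Fin (s +ℕ (r +ℕ r))) → ℕ → List (Literal (Fin s)) → Poly (Fin s ⊎ Fin r) →
         Square (s +ℕ (r +ℕ r))

  symmetrised : ∀ {k} → Square k → Poly (Fin k)
  symmetrised (sq s r lts w τ φ) = orbit (arrangements lts) (square s r w τ φ)

  expand : List (Square 6) → Poly (Fin 6)
  expand = concatMap symmetrised

  -- The flags are chosen so that each square averages to zero on a balanced bipartition; the weights come from a
  -- semidefinite program.
  squares : List (Square 6)
  squares =
      -- Four labels in one part. On six vertices of one part the value 180 comes from the 15
      -- arrangements of this square alone, which forces the weight 12.
      sq 4 1 ((0F , 1F) ∷ (1F , 2F) ∷ (2F , 3F) ∷ (4F , 5F) ∷ []) 12 (type₄ I I I I)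
        ( (1ℤ  , link (I ∷ I ∷ I ∷ I ∷ I ∷ I ∷ []))
        ∷ (-1ℤ , link none) ∷ [])
    -- Three labels in one part, the fourth in the other: a flag vertex of the bipartition then has
    -- one of the first two links. The other six flags do not occur there, so their coefficients
    -- leave the average at zero.
    ∷ sq 4 1 ((0F , 1F) ∷ (1F , 2F) ∷ (4F , 5F) ∷ []) 11 (type₄ I O O O)
        ( (1ℤ  , link (I ∷ I ∷ O ∷ I ∷ O ∷ O ∷ []))
        ∷ (-1ℤ , link none)
        ∷ (1ℤ  , link (O ∷ O ∷ I ∷ O ∷ O ∷ O ∷ []))
        ∷ (1ℤ  , link (O ∷ O ∷ O ∷ O ∷ I ∷ O ∷ []))
        ∷ (1ℤ  , link (O ∷ O ∷ O ∷ O ∷ O ∷ I ∷ []))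
        ∷ (1ℤ  , link (O ∷ O ∷ I ∷ O ∷ I ∷ O ∷ []))
        ∷ (1ℤ  , link (O ∷ O ∷ I ∷ O ∷ O ∷ I ∷ []))
        ∷ (1ℤ  , link (O ∷ O ∷ O ∷ O ∷ I ∷ I ∷ [])) ∷ [])
    -- Together with the preceding square this is a positive semidefinite block of rank two, with
    -- total weight 12 on the two flags that the bipartition shows.
    ∷ sq 4 1 ((0F , 1F) ∷ (1F , 2F) ∷ (4F , 5F) ∷ []) 1 (type₄ I O O O)
        ( (1ℤ  , link (I ∷ I ∷ O ∷ I ∷ O ∷ O ∷ []))
        ∷ (-1ℤ , link none) ∷ [])
    -- Two labels in each part. Exchanging the pairs 01 and 23 negates the flag sum and keeps its
    -- square, hence the request for `0F` before `2F`.
    ∷ sq 4 1 ((0F , 1F) ∷ (2F , 3F) ∷ (0F , 2F) ∷ (4F , 5F) ∷ []) 12 (type₄ O O O O)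
        ( (1ℤ  , link (I ∷ O ∷ O ∷ O ∷ O ∷ O ∷ []))
        ∷ (-1ℤ , link (O ∷ O ∷ O ∷ O ∷ O ∷ I ∷ [])) ∷ [])
    -- No four vertices of a bipartition span exactly two edges, so this type has weight zero there.
    ∷ sq 4 1 ((0F , 1F) ∷ (2F , 3F) ∷ (4F , 5F) ∷ []) 32 (type₄ I I O O)
        ( (1ℤ  , link none)
        ∷ (-1ℤ , link (O ∷ O ∷ O ∷ O ∷ O ∷ I ∷ [])) ∷ [])
    -- In the bipartition these flags occur when the two labels lie in different parts and both flag
    -- vertices lie on the side of one of them.
    ∷ sq 2 2 ((0F , 1F) ∷ (2F , 3F) ∷ (4F , 5F) ∷ (2F , 4F) ∷ []) 8 []
        ( (1ℤ  , flag I O)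
        ∷ (-1ℤ , flag O I) ∷ [])
    ∷ []
    where
    flag : Bool → Bool → List (Literal (Fin 2 ⊎ Fin 2))
    flag a b = ((x , y , u) , O) ∷ ((x , y , v) , O) ∷ ((x , u , v) , a) ∷ ((y , u , v) , b) ∷ []
      where
      x y u v : Fin 2 ⊎ Fin 2
      x = inj₁ 0F
      y = inj₁ 1F
      u = inj₂ 0F
      v = inj₂ 1F

  noneOf : ∀ {L : Set} → List (L × L × L) → List (Literal L)
  noneOf = map (_, O)

  oneOf : ∀ {L : Set} → List (L × L × L) → Poly L
  oneOf []       = []
  oneOf (t ∷ ts) = (1ℤ , (t , I) ∷ noneOf ts) ∷ map (λ (c , m) → c , (t , O) ∷ m) (oneOf ts)

  triples₅ : List (Fin 5 × Fin 5 × Fin 5)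
  triples₅ = (0F , 1F , 2F) ∷ (0F , 1F , 3F) ∷ (0F , 2F , 3F) ∷ (1F , 2F , 3F) ∷ (0F , 1F , 4F) ∷ (0F , 2F , 4F)
    ∷ (1F , 2F , 4F) ∷ (0F , 3F , 4F) ∷ (1F , 3F , 4F) ∷ (2F , 3F , 4F) ∷ []

  weighted : ℕ → Poly (Fin 5) → Poly (Fin 6)
  weighted w p = ((+ w , []) ∷ []) ⊗ rename (_↑ˡ 1) p

  objective : List (Code 6) → Poly (Fin 6)
  objective css = orbit css (weighted 48 (oneOf triples₅))

  fiveSets : List (Code 6)
  fiveSets = arrangements ((0F , 1F) ∷ (1F , 2F) ∷ (2F , 3F) ∷ (3F , 4F) ∷ [])

  -- Colexicographic order, hence increasing codes: the branching order is the order used by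
  -- `sortLiterals`. Edges within few labels are settled first, which decides the types of many
  -- squares early.
  variables : List ℕ
  variables = map encode
    ( (0F , 1F , 2F) ∷ (0F , 1F , 3F) ∷ (0F , 2F , 3F) ∷ (1F , 2F , 3F) ∷ (0F , 1F , 4F) ∷ (0F , 2F , 4F)
    ∷ (1F , 2F , 4F) ∷ (0F , 3F , 4F) ∷ (1F , 3F , 4F) ∷ (2F , 3F , 4F) ∷ (0F , 1F , 5F) ∷ (0F , 2F , 5F)
    ∷ (1F , 2F , 5F) ∷ (0F , 3F , 5F) ∷ (1F , 3F , 5F) ∷ (2F , 3F , 5F) ∷ (0F , 4F , 5F) ∷ (1F , 4F , 5F)
    ∷ (2F , 4F , 5F) ∷ (3F , 4F , 5F) ∷ [])

  certificate-bounded : bounded (+ 180) variables (toTerms (objective fiveSets ++ expand squares)) ≡ true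
  certificate-bounded = refl

  count : List Bool → ℕ
  count []       = 0
  count (b ∷ bs) = (if b then suc else λ k → k) (count bs)

  0≤i*i : ∀ i → 0ℤ ≤ i * i
  0≤i*i (+ n)      = subst (0ℤ ≤_) (pos-* n n) (+≤+ ℕ.z≤n)
  0≤i*i -[1+ n ]   = +≤+ ℕ.z≤n

  0≤i*j : ∀ {i j} → 0ℤ ≤ i → 0ℤ ≤ j → 0ℤ ≤ i * j
  0≤i*j {+ m} {+ n} _ _ = subst (0ℤ ≤_) (pos-* m n) (+≤+ ℕ.z≤n)

  module _ {n : ℕ} (E : Fin n → Fin n → Fin n → Bool) where
    open Evaluation E

    ∑ev : ∀ {k} → Poly (Fin k) → ℤ
    ∑ev {k} p = ∑ᵛ k λ v → ev (lookup v) p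

    ∑ev-++ : ∀ {k} (p q : Poly (Fin k)) → ∑ev (p ++ q) ≡ ∑ev p + ∑ev q
    ∑ev-++ {k} p q = trans (∑ᵛ-cong k λ v → ev-++ (lookup v) p q) (∑ᵛ-+ k (λ v → ev (lookup v) p) (λ v → ev (lookup v) q))

    -- Renaming by an arrangement permutes the summation variables, so all summands of an orbit have
    -- the same sum. The sample sum sees only how many arrangements there are, while the pointwise
    -- check sees the symmetrised polynomial.
    ∑ev-orbit : ∀ {k} css (p : Poly (Fin k)) → ∑ev (orbit css p) ≡ + length css * ∑ev p
    ∑ev-orbit {k} []         p = trans (∑ᵛ-const {n} k 0ℤ) (trans (*-zeroʳ (+ (n ^ℕ k))) (sym (*-zeroˡ (∑ev p))))
    ∑ev-orbit {k} (cs ∷ css) p = begin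
      ∑ev (rename (position cs) p ++ orbit css p)       ≡⟨ ∑ev-++ (rename (position cs) p) (orbit css p) ⟩
      ∑ev (rename (position cs) p) + ∑ev (orbit css p)  ≡⟨ cong₂ _+_ permuted (∑ev-orbit css p) ⟩
      ∑ev p + + length css * ∑ev p                      ≡⟨ eq (∑ev p) (+ length css) ⟩
      + suc (length css) * ∑ev p                        ∎
      where
      open ≡-Reasoning
      eq : ∀ x m → x + m * x ≡ (1ℤ + m) * x
      eq = solve-∀
      permuted : ∑ev (rename (position cs) p) ≡ ∑ev p
      permuted = trans (∑ᵛ-cong k λ v → ev-rename (lookup-act cs v) p) (∑ᵛ-act cs λ v → ev (lookup v) p)

    module _ (s r w : ℕ) (τ : List (Literal (Fin s))) (φ : Poly (Fin s ⊎ Fin r)) where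

      -- For fixed shared vertices the two flag tuples range independently over all tuples, so their
      -- double sum factors as a non-negative weight times a square.
      0≤∑ev-square : 0ℤ ≤ ∑ev (square s r w τ φ)
      0≤∑ev-square = subst (0ℤ ≤_) (sym ∑ev-square)
        (≤-trans (≤-reflexive (sym (trans (∑ᵛ-const {n} s 0ℤ) (*-zeroʳ (+ (n ^ℕ s)))))) (∑ᵛ-mono s 0≤term))
        where
        open ≡-Reasoning

        weight : Vec (Fin n) s → ℤ
        weight x = + w * monomial (lookup x) τ

        flags : Vec (Fin n) s → Vec (Fin n) r → ℤ
        flags x y = ev [ lookup x , lookup y ]′ φ

        pointwise : ∀ x y z → ev (lookup (x ++ᵛ (y ++ᵛ z))) (square s r w τ φ) ≡ weight x * (flags x y * flags x z)
        pointwise x y z = begin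
          ev ρ (square s r w τ φ)
            ≡⟨ ev-⊗ ρ ((+ w , map (renameₗ (_↑ˡ (r +ℕ r))) τ) ∷ []) (φ₁ ⊗ φ₂) ⟩
          (+ w * monomial ρ (map (renameₗ (_↑ˡ (r +ℕ r))) τ) + 0ℤ) * ev ρ (φ₁ ⊗ φ₂)
            ≡⟨ cong₂ _*_ (trans (+-identityʳ _) (cong (+ w *_) (monomial-rename (λ i → sym (lookup-++ˡ x (y ++ᵛ z) i)) τ)))
                         (trans (ev-⊗ ρ φ₁ φ₂) (cong₂ _*_ (ev-rename first φ) (ev-rename second φ))) ⟩
          weight x * (flags x y * flags x z) ∎
          where
          ρ = lookup (x ++ᵛ (y ++ᵛ z))
          φ₁ = rename (embed₁ s r) φ
          φ₂ = rename (embed₂ s r) φ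
          first : ∀ i → [ lookup x , lookup y ]′ i ≡ ρ (embed₁ s r i)
          first (inj₁ i) = sym (lookup-++ˡ x (y ++ᵛ z) i)
          first (inj₂ i) = sym (trans (lookup-++ʳ x (y ++ᵛ z) (i ↑ˡ r)) (lookup-++ˡ y z i))
          second : ∀ i → [ lookup x , lookup z ]′ i ≡ ρ (embed₂ s r i)
          second (inj₁ i) = sym (lookup-++ˡ x (y ++ᵛ z) i)
          second (inj₂ i) = sym (trans (lookup-++ʳ x (y ++ᵛ z) (r ↑ʳ i)) (lookup-++ʳ y z i))

        ∑ev-square : ∑ev (square s r w τ φ) ≡ ∑ᵛ s λ x → weight x * (∑ᵛ r (flags x) * ∑ᵛ r (flags x))
        ∑ev-square = begin
          ∑ev (square s r w τ φ)
            ≡⟨ ∑ᵛ-++ s (λ v → ev (lookup v) (square s r w τ φ)) ⟩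
          ∑ᵛ s (λ x → ∑ᵛ (r +ℕ r) λ u → ev (lookup (x ++ᵛ u)) (square s r w τ φ))
            ≡⟨ ∑ᵛ-cong s (λ x → trans (∑ᵛ-++ r (λ u → ev (lookup (x ++ᵛ u)) (square s r w τ φ)))
                 (∑ᵛ-cong r λ y → trans (∑ᵛ-cong r (pointwise x y)) (∑ᵛ-* r (weight x) (λ z → flags x y * flags x z)))) ⟩
          ∑ᵛ s (λ x → ∑ᵛ r λ y → weight x * ∑ᵛ r λ z → flags x y * flags x z)
            ≡⟨ ∑ᵛ-cong s (λ x → trans (∑ᵛ-* r (weight x) (λ y → ∑ᵛ r λ z → flags x y * flags x z))
                 (cong (weight x *_) (∑ᵛ-square r (flags x)))) ⟩
          ∑ᵛ s (λ x → weight x * (∑ᵛ r (flags x) * ∑ᵛ r (flags x))) ∎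

        0≤term : ∀ x → 0ℤ ≤ weight x * (∑ᵛ r (flags x) * ∑ᵛ r (flags x))
        0≤term x = 0≤i*j (0≤i*j {+ w} (+≤+ ℕ.z≤n) (0≤monomial (lookup x) τ)) (0≤i*i (∑ᵛ r (flags x)))

    0≤∑ev-symmetrised : ∀ {k} (q : Square k) → 0ℤ ≤ ∑ev (symmetrised q)
    0≤∑ev-symmetrised (sq s r lts w τ φ) = subst (0ℤ ≤_) (sym (∑ev-orbit (arrangements lts) (square s r w τ φ)))
      (0≤i*j {+ length (arrangements lts)} (+≤+ ℕ.z≤n) (0≤∑ev-square s r w τ φ))

    0≤∑ev-expand : ∀ sqs → 0ℤ ≤ ∑ev (expand sqs)
    0≤∑ev-expand []        = ≤-reflexive (sym (trans (∑ᵛ-const {n} 6 0ℤ) (*-zeroʳ (+ (n ^ℕ 6)))))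
    0≤∑ev-expand (q ∷ sqs) = subst (0ℤ ≤_) (sym (∑ev-++ (symmetrised q) (expand sqs)))
      (+-mono-≤ (0≤∑ev-symmetrised q) (0≤∑ev-expand sqs))

    module _ {L : Set} (ρ : L → Fin n) where

      monomial-noneOf : ∀ ts → monomial ρ (noneOf ts) ≡ 𝟙 (count (map (edge ρ) ts) ≡ᵇ 0)
      monomial-noneOf []       = refl
      monomial-noneOf (t ∷ ts) with edge ρ t
      ... | true  = *-zeroˡ (monomial ρ (noneOf ts))
      ... | false = trans (*-identityˡ (monomial ρ (noneOf ts))) (monomial-noneOf ts)

      ev-oneOf : ∀ ts → ev ρ (oneOf ts) ≡ 𝟙 (count (map (edge ρ) ts) ≡ᵇ 1)
      ev-oneOf []       = refl
      ev-oneOf (t ∷ ts) = trans (cong (_+_ (1ℤ * (𝟙 (edge ρ t) * monomial ρ (noneOf ts)))) (ev-absent (oneOf ts))) step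
        where
        absent : Poly L → Poly L
        absent = map λ (c , m) → c , (t , O) ∷ m
        eq : ∀ c x y z → c * (x * y) + x * z ≡ x * (c * y + z)
        eq = solve-∀
        ev-absent : ∀ p → ev ρ (absent p) ≡ 𝟙 (not (edge ρ t)) * ev ρ p
        ev-absent []            = sym (*-zeroʳ (𝟙 (not (edge ρ t))))
        ev-absent ((c , m) ∷ p) =
          trans (cong (_+_ (c * (𝟙 (not (edge ρ t)) * monomial ρ m))) (ev-absent p)) (eq c (𝟙 (not (edge ρ t))) (monomial ρ m) (ev ρ p))
        step : 1ℤ * (𝟙 (edge ρ t) * monomial ρ (noneOf ts)) + 𝟙 (not (edge ρ t)) * ev ρ (oneOf ts)
               ≡ 𝟙 (count (edge ρ t ∷ map (edge ρ) ts) ≡ᵇ 1)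
        step with edge ρ t
        ... | true  = trans (cong₂ _+_ (trans (*-identityˡ (1ℤ * monomial ρ (noneOf ts))) (*-identityˡ (monomial ρ (noneOf ts)))) (*-zeroˡ (ev ρ (oneOf ts))))
                        (trans (+-identityʳ (monomial ρ (noneOf ts))) (monomial-noneOf ts))
        ... | false = trans (cong₂ _+_ (trans (*-identityˡ (0ℤ * monomial ρ (noneOf ts))) (*-zeroˡ (monomial ρ (noneOf ts)))) (*-identityˡ (ev ρ (oneOf ts))))
                        (trans (+-identityˡ (ev ρ (oneOf ts))) (ev-oneOf ts))

    ∑ev-weighted : ∀ w p → ∑ev (weighted w p) ≡ + w * (+ n * ∑ev p)
    ∑ev-weighted w p = begin
      ∑ev (weighted w p)
        ≡⟨ ∑ᵛ-++ 5 {1} (λ v → ev (lookup v) (weighted w p)) ⟩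
      ∑ᵛ 5 (λ v → ∑ᵛ 1 λ u → ev (lookup (v ++ᵛ u)) (weighted w p))
        ≡⟨ ∑ᵛ-cong 5 (λ v → trans (∑ᵛ-cong 1 (pointwise v)) (sum-const n (+ w * ev (lookup v) p))) ⟩
      ∑ᵛ 5 (λ v → + n * (+ w * ev (lookup v) p))
        ≡⟨ ∑ᵛ-* 5 (+ n) (λ v → + w * ev (lookup v) p) ⟩
      + n * ∑ᵛ 5 (λ v → + w * ev (lookup v) p)
        ≡⟨ cong (+ n *_) (∑ᵛ-* 5 (+ w) λ v → ev (lookup v) p) ⟩
      + n * (+ w * ∑ev p)
        ≡⟨ eq (+ n) (+ w) (∑ev p) ⟩
      + w * (+ n * ∑ev p) ∎
      where
      open ≡-Reasoning
      eq : ∀ m w x → m * (w * x) ≡ w * (m * x)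
      eq = solve-∀
      pointwise : ∀ v u → ev (lookup (v ++ᵛ u)) (weighted w p) ≡ + w * ev (lookup v) p
      pointwise v u = trans (ev-⊗ (lookup (v ++ᵛ u)) ((+ w , []) ∷ []) (rename (_↑ˡ 1) p))
        (cong₂ _*_ (trans (+-identityʳ _) (*-identityʳ (+ w))) (ev-rename (λ i → sym (lookup-++ˡ v u i)) p))

    edges₅ : Vec (Fin n) 5 → List Bool
    edges₅ v = map (edge (lookup v)) triples₅

  module _ {n : ℕ} (E : Fin n → Fin n → Fin n → Bool)
           (E-swap₁₂ : ∀ x y z → E x y z ≡ E y x z) (E-swap₂₃ : ∀ x y z → E x y z ≡ E x z y) where
    open Evaluation E

    module _ (css : List (Code 6)) (sqs : List (Square 6)) (xs : List ℕ)
             (ok : bounded (+ 180) xs (toTerms (objective css ++ expand sqs)) ≡ true) where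

      -- The certificate enters through parameters: the argument uses only the check `ok` and the
      -- number of arrangements in `css`, so the large polynomial stays folded.
      ∑ev-objective≤ : + length css * (+ 48 * (+ n * ∑ev E (oneOf triples₅))) ≤ + (n ^ℕ 6) * + 180
      ∑ev-objective≤ = begin
        + length css * (+ 48 * (+ n * ∑ev E (oneOf triples₅)))  ≡⟨ cong (+ length css *_) (∑ev-weighted E 48 (oneOf triples₅)) ⟨
        + length css * ∑ev E (weighted 48 (oneOf triples₅))     ≡⟨ ∑ev-orbit E css (weighted 48 (oneOf triples₅)) ⟨
        ∑ev E (objective css)                                   ≡⟨ +-identityʳ _ ⟨
        ∑ev E (objective css) + 0ℤ                              ≤⟨ +-monoʳ-≤ (∑ev E (objective css)) (0≤∑ev-expand E sqs) ⟩
        ∑ev E (objective css) + ∑ev E (expand sqs)              ≡⟨ ∑ev-++ E (objective css) (expand sqs) ⟨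
        ∑ev E (objective css ++ expand sqs)
          ≤⟨ ∑ᵛ-mono 6 (λ v → Symmetric.ev≤ E E-swap₁₂ E-swap₂₃ (lookup v) (+ 180) (objective css ++ expand sqs) xs ok) ⟩
        ∑ᵛ {n} 6 (λ _ → + 180)                                  ≡⟨ ∑ᵛ-const {n} 6 (+ 180) ⟩
        + (n ^ℕ 6) * + 180                                      ∎
        where open ≤-Reasoning

    oneEdge-density : + 8 * ∑ev E (oneOf triples₅) ≤ + 5 * + (n ^ℕ 5)
    oneEdge-density = cancel n refl (∑ev-objective≤ fiveSets squares variables certificate-bounded)
      where
      -- `E` depends on `n`, so the case split goes through a copy `m`. Without vertices both sides
      -- are 0; otherwise 36n cancels, by 6 · 48 = 36 · 8 and 180 = 36 · 5.
      cancel : ∀ m → m ≡ n → + 6 * (+ 48 * (+ n * ∑ev E (oneOf triples₅))) ≤ + (n ^ℕ 6) * + 180 →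
               + 8 * ∑ev E (oneOf triples₅) ≤ + 5 * + (n ^ℕ 5)
      cancel zero    refl _  = ≤-refl
      cancel (suc m) refl le = *-cancelˡ-≤-pos _ _ (+ 36 * + n) (subst₂ _≤_ (eq₁ (+ n) (∑ev E (oneOf triples₅)))
        (trans (cong (_* + 180) (pos-* n (n ^ℕ 5))) (eq₂ (+ n) (+ (n ^ℕ 5)))) le)
        where
        eq₁ : ∀ a b → + 6 * (+ 48 * (a * b)) ≡ + 36 * a * (+ 8 * b)
        eq₁ = solve-∀
        eq₂ : ∀ a b → a * b * + 180 ≡ + 36 * a * (+ 5 * b)
        eq₂ = solve-∀

    ∑oneEdge≤ : + 8 * ∑ᵛ 5 (λ v → 𝟙 (count (edges₅ E v) ≡ᵇ 1)) ≤ + 5 * + (n ^ℕ 5)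
    ∑oneEdge≤ = subst (λ x → + 8 * x ≤ + 5 * + (n ^ℕ 5)) (∑ᵛ-cong 5 λ v → ev-oneOf E (lookup v) triples₅) oneEdge-density

open Certificate

-- From sums over tuples to sums over subsets

module SubsetSums where

  open import Data.Bool using (Bool; true; false; not; _∧_)
  open import Data.Bool.Properties using (∧-zeroʳ)
  open import Data.Fin using (Fin; zero; suc)
  open import Data.Fin.Subset using (Subset; ∣_∣; ⊥; inside)
  open import Data.Integer using (ℤ; +_; 0ℤ; 1ℤ; _+_; _*_)
  open import Data.Integer.Properties
    using (+-injective; +-comm; +-identityˡ; +-identityʳ; +-assoc; pos-+; *-comm;
           *-identityˡ; *-identityʳ; *-zeroˡ; *-zeroʳ; *-assoc; *-distribʳ-+; *-distribˡ-+; +-*-semiring; pos-*)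
  open import Data.Integer.Tactic.RingSolver using (solve-∀)
  open import Data.List using (List; []; _∷_; _++_; map; length; filterᵇ)
  open import Data.Nat using (ℕ; zero; suc; _≡ᵇ_; _!) renaming (_+_ to _+ℕ_)
  import Data.Nat.Properties as ℕₚ
  open import Data.Nat.Combinatorics using (_C_; nCk+nC[k+1]≡[n+1]C[k+1])
  open import Data.Vec using (Vec; lookup; []; _∷_; _[_]≔_)
  open import Function using (_∘_)
  open import Relation.Binary.PropositionalEquality
  open import Algebra.Properties.Semiring.Sum +-*-semiring using (sum; sum-cong-≗; ∑-distrib-+; *-distribˡ-sum)

  -- Sums over subsets

  ∑ˢ : ∀ n → (Subset n → ℤ) → ℤ
  ∑ˢ zero    f = f []
  ∑ˢ (suc n) f = ∑ˢ n (f ∘ (false ∷_)) + ∑ˢ n (f ∘ (true ∷_))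

  # : {A : Set} → (A → Bool) → List A → ℤ
  # p xs = + length (filterᵇ p xs)

  #-∷ : ∀ {A : Set} (p : A → Bool) x xs → # p (x ∷ xs) ≡ 𝟙 (p x) + # p xs
  #-∷ p x xs with p x
  ... | true  = refl
  ... | false = sym (+-identityˡ _)

  #-++ : ∀ {A : Set} (p : A → Bool) xs ys → # p (xs ++ ys) ≡ # p xs + # p ys
  #-++ p []       ys = sym (+-identityˡ _)
  #-++ p (x ∷ xs) ys = begin
    # p (x ∷ xs ++ ys)             ≡⟨ #-∷ p x (xs ++ ys) ⟩
    𝟙 (p x) + # p (xs ++ ys)       ≡⟨ cong (_+_ (𝟙 (p x))) (#-++ p xs ys) ⟩
    𝟙 (p x) + (# p xs + # p ys)    ≡⟨ +-assoc (𝟙 (p x)) _ _ ⟨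
    𝟙 (p x) + # p xs + # p ys      ≡⟨ cong (λ z → z + # p ys) (#-∷ p x xs) ⟨
    # p (x ∷ xs) + # p ys          ∎
    where open ≡-Reasoning

  #-map : ∀ {A B : Set} (p : B → Bool) (f : A → B) xs → # p (map f xs) ≡ # (p ∘ f) xs
  #-map p f []       = refl
  #-map p f (x ∷ xs) = begin
    # p (f x ∷ map f xs)           ≡⟨ #-∷ p (f x) (map f xs) ⟩
    𝟙 (p (f x)) + # p (map f xs)   ≡⟨ cong (_+_ (𝟙 (p (f x)))) (#-map p f xs) ⟩
    𝟙 (p (f x)) + # (p ∘ f) xs     ≡⟨ #-∷ (p ∘ f) x xs ⟨
    # (p ∘ f) (x ∷ xs)             ∎
    where open ≡-Reasoning

  #-subsets : ∀ n (p : Subset n → Bool) → # p (subsets n) ≡ ∑ˢ n (𝟙 ∘ p)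
  #-subsets zero    p = trans (#-∷ p [] []) (+-identityʳ _)
  #-subsets (suc n) p = trans (#-++ p (map (false ∷_) (subsets n)) _)
    (cong₂ _+_ (trans (#-map p (false ∷_) (subsets n)) (#-subsets n _)) (trans (#-map p (true ∷_) (subsets n)) (#-subsets n _)))

  ∑ˢ-cong : ∀ n {f g : Subset n → ℤ} → (∀ S → f S ≡ g S) → ∑ˢ n f ≡ ∑ˢ n g
  ∑ˢ-cong zero    f≗g = f≗g []
  ∑ˢ-cong (suc n) f≗g = cong₂ _+_ (∑ˢ-cong n λ S → f≗g (false ∷ S)) (∑ˢ-cong n λ S → f≗g (true ∷ S))

  ∑ˢ-0 : ∀ n {f : Subset n → ℤ} → (∀ S → f S ≡ 0ℤ) → ∑ˢ n f ≡ 0ℤ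
  ∑ˢ-0 zero    f≗0 = f≗0 []
  ∑ˢ-0 (suc n) f≗0 = cong₂ _+_ (∑ˢ-0 n λ S → f≗0 (false ∷ S)) (∑ˢ-0 n λ S → f≗0 (true ∷ S))

  interchange : ∀ a b c d → (a + b) + (c + d) ≡ (a + c) + (b + d)
  interchange = solve-∀

  ∑ˢ-+ : ∀ n (f g : Subset n → ℤ) → ∑ˢ n (λ S → f S + g S) ≡ ∑ˢ n f + ∑ˢ n g
  ∑ˢ-+ zero    f g = refl
  ∑ˢ-+ (suc n) f g = trans
    (cong₂ _+_ (∑ˢ-+ n (f ∘ (false ∷_)) (g ∘ (false ∷_))) (∑ˢ-+ n (f ∘ (true ∷_)) (g ∘ (true ∷_))))
    (interchange (∑ˢ n (f ∘ (false ∷_))) (∑ˢ n (g ∘ (false ∷_))) (∑ˢ n (f ∘ (true ∷_))) (∑ˢ n (g ∘ (true ∷_))))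

  ∑ˢ-* : ∀ n c (f : Subset n → ℤ) → ∑ˢ n (λ S → c * f S) ≡ c * ∑ˢ n f
  ∑ˢ-* zero    c f = refl
  ∑ˢ-* (suc n) c f = trans (cong₂ _+_ (∑ˢ-* n c (f ∘ (false ∷_))) (∑ˢ-* n c (f ∘ (true ∷_))))
    (sym (*-distribˡ-+ c (∑ˢ n (f ∘ (false ∷_))) (∑ˢ n (f ∘ (true ∷_)))))

  ∑ˢ-sum : ∀ n {m} (f : Fin m → Subset n → ℤ) → ∑ˢ n (λ S → sum λ i → f i S) ≡ sum λ i → ∑ˢ n (f i)
  ∑ˢ-sum zero    f = refl
  ∑ˢ-sum (suc n) f = trans
    (cong₂ _+_ (∑ˢ-sum n λ i → f i ∘ (false ∷_)) (∑ˢ-sum n λ i → f i ∘ (true ∷_)))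
    (sym (∑-distrib-+ (λ i → ∑ˢ n (f i ∘ (false ∷_))) (λ i → ∑ˢ n (f i ∘ (true ∷_)))))

  ∑ˢ-binomial : ∀ n k → ∑ˢ n (λ S → 𝟙 (∣ S ∣ ≡ᵇ k)) ≡ + (n C k)
  ∑ˢ-binomial zero    zero    = refl
  ∑ˢ-binomial zero    (suc k) = refl
  ∑ˢ-binomial (suc n) zero    = trans (cong₂ _+_ (∑ˢ-binomial n zero) (∑ˢ-0 n λ _ → refl)) refl
  ∑ˢ-binomial (suc n) (suc k) = trans (cong₂ _+_ (∑ˢ-binomial n (suc k)) (∑ˢ-binomial n k))
    (trans (sym (pos-+ (n C suc k) (n C k))) (cong +_ (trans (ℕₚ.+-comm (n C suc k) (n C k)) (nCk+nC[k+1]≡[n+1]C[k+1] n k))))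

  -- Subsets with listed elements

  ins : ∀ {n} → Fin n → Subset n → Subset n
  ins i S = S [ i ]≔ inside

  outsideᵇ : ∀ {n} → Fin n → Subset n → Bool
  outsideᵇ i S = not (lookup S i)

  ins-comm : ∀ {n} (i j : Fin n) S → ins i (ins j S) ≡ ins j (ins i S)
  ins-comm zero    zero    (b ∷ S) = refl
  ins-comm zero    (suc j) (b ∷ S) = refl
  ins-comm (suc i) zero    (b ∷ S) = refl
  ins-comm (suc i) (suc j) (b ∷ S) = cong (b ∷_) (ins-comm i j S)

  ∣ins∣ : ∀ {n} (i : Fin n) S → outsideᵇ i S ≡ true → ∣ ins i S ∣ ≡ suc ∣ S ∣
  ∣ins∣ zero    (false ∷ S) _  = refl
  ∣ins∣ (suc i) (false ∷ S) i∉ = ∣ins∣ i S i∉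
  ∣ins∣ (suc i) (true ∷ S)  i∉ = cong suc (∣ins∣ i S i∉)

  -- Each T arises from |T| choices of the inserted vertex.
  ∑ˢ-ins : ∀ n (f : Subset n → ℤ) → ∑ˢ n (λ S → sum λ i → 𝟙 (outsideᵇ i S) * f (ins i S)) ≡ ∑ˢ n λ T → + ∣ T ∣ * f T
  ∑ˢ-ins zero    f = sym (*-zeroˡ (f []))
  ∑ˢ-ins (suc n) f = begin
    ∑ˢ n (λ S → 1ℤ * f₁ S + rest f₀ S) + ∑ˢ n (λ S → 0ℤ * f₁ S + rest f₁ S)
      ≡⟨ cong₂ _+_ (∑ˢ-+ n (λ S → 1ℤ * f₁ S) (rest f₀)) (∑ˢ-cong n λ S → trans (cong (λ z → z + rest f₁ S) (*-zeroˡ (f₁ S))) (+-identityˡ _)) ⟩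
    ∑ˢ n (λ S → 1ℤ * f₁ S) + ∑ˢ n (rest f₀) + ∑ˢ n (rest f₁)
      ≡⟨ cong₂ (λ x y → ∑ˢ n (λ S → 1ℤ * f₁ S) + x + y) (∑ˢ-ins n f₀) (∑ˢ-ins n f₁) ⟩
    ∑ˢ n (λ S → 1ℤ * f₁ S) + ∑ˢ n (λ T → + ∣ T ∣ * f₀ T) + ∑ˢ n (λ T → + ∣ T ∣ * f₁ T)
      ≡⟨ rotate (∑ˢ n (λ S → 1ℤ * f₁ S)) (∑ˢ n (λ T → + ∣ T ∣ * f₀ T)) (∑ˢ n (λ T → + ∣ T ∣ * f₁ T)) ⟩
    ∑ˢ n (λ T → + ∣ T ∣ * f₀ T) + (∑ˢ n (λ S → 1ℤ * f₁ S) + ∑ˢ n (λ T → + ∣ T ∣ * f₁ T))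
      ≡⟨ cong (_+_ (∑ˢ n (λ T → + ∣ T ∣ * f₀ T))) (∑ˢ-+ n (λ S → 1ℤ * f₁ S) (λ T → + ∣ T ∣ * f₁ T)) ⟨
    ∑ˢ n (λ T → + ∣ T ∣ * f₀ T) + ∑ˢ n (λ T → 1ℤ * f₁ T + + ∣ T ∣ * f₁ T)
      ≡⟨ cong (_+_ (∑ˢ n (λ T → + ∣ T ∣ * f₀ T))) (∑ˢ-cong n λ T → sym (*-distribʳ-+ (f₁ T) 1ℤ (+ ∣ T ∣))) ⟩
    ∑ˢ n (λ T → + ∣ T ∣ * f₀ T) + ∑ˢ n (λ T → + suc ∣ T ∣ * f₁ T) ∎
    where
    open ≡-Reasoning
    f₀ f₁ : Subset n → ℤ
    f₀ = f ∘ (false ∷_)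
    f₁ = f ∘ (true ∷_)
    rest : (Subset n → ℤ) → Subset n → ℤ
    rest g S = sum λ i → 𝟙 (outsideᵇ i S) * g (ins i S)
    rotate : ∀ a b c → a + b + c ≡ b + (a + c)
    rotate = solve-∀

  build : ∀ {n k} → Vec (Fin n) k → Subset n
  build []      = ⊥
  build (x ∷ v) = ins x (build v)

  distinct : ∀ {n k} → Vec (Fin n) k → Bool
  distinct []      = true
  distinct (x ∷ v) = outsideᵇ x (build v) ∧ distinct v

  ∑ˢ-∅ : ∀ n (f : Subset n → ℤ) → ∑ˢ n (λ S → 𝟙 (∣ S ∣ ≡ᵇ 0) * f S) ≡ f ⊥
  ∑ˢ-∅ zero    f = *-identityˡ (f [])
  ∑ˢ-∅ (suc n) f = trans (cong₂ _+_ (∑ˢ-∅ n (f ∘ (false ∷_))) (∑ˢ-0 n λ S → *-zeroˡ (f (true ∷ S)))) (+-identityʳ _)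

  𝟙-∧ : ∀ a b → 𝟙 (a ∧ b) ≡ 𝟙 a * 𝟙 b
  𝟙-∧ true  b = sym (*-identityˡ _)
  𝟙-∧ false b = sym (*-zeroˡ (𝟙 b))

  -- Induction on `k`: the new head ranges over the vertices outside `build v`, and by `∑ˢ-ins`
  -- every (k+1)-set arises from k+1 pairs of a k-set and a new vertex. This turns the factor k!
  -- into (k+1)!.
  ∑ᵛ-distinct : ∀ {n} k (f : Subset n → ℤ) →
    ∑ᵛ k (λ v → 𝟙 (distinct v) * f (build v)) ≡ + (k !) * ∑ˢ n λ S → 𝟙 (∣ S ∣ ≡ᵇ k) * f S
  ∑ᵛ-distinct {n} zero    f = cong (1ℤ *_) (sym (∑ˢ-∅ n f))
  ∑ᵛ-distinct {n} (suc k) f = begin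
    sum (λ x → ∑ᵛ k λ v → 𝟙 (outsideᵇ x (build v) ∧ distinct v) * f (ins x (build v)))
      ≡⟨ sum-∑ᵛ-comm k (λ x v → 𝟙 (outsideᵇ x (build v) ∧ distinct v) * f (ins x (build v))) ⟩
    ∑ᵛ k (λ v → sum λ x → 𝟙 (outsideᵇ x (build v) ∧ distinct v) * f (ins x (build v)))
      ≡⟨ ∑ᵛ-cong k (λ v → trans
           (sum-cong-≗ λ x → trans (cong (_* f (ins x (build v))) (𝟙-∧ (outsideᵇ x (build v)) (distinct v)))
             (swap (𝟙 (outsideᵇ x (build v))) (𝟙 (distinct v)) (f (ins x (build v)))))
           (sym (*-distribˡ-sum {n} (𝟙 (distinct v)) (λ x → 𝟙 (outsideᵇ x (build v)) * f (ins x (build v)))))) ⟩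
    ∑ᵛ k (λ v → 𝟙 (distinct v) * f⁺ (build v))
      ≡⟨ ∑ᵛ-distinct k f⁺ ⟩
    + (k !) * ∑ˢ n (λ S → 𝟙 (∣ S ∣ ≡ᵇ k) * f⁺ S)
      ≡⟨ cong (+ (k !) *_) (∑ˢ-cong n λ S → trans (*-distribˡ-sum {n} (𝟙 (∣ S ∣ ≡ᵇ k)) (λ x → 𝟙 (outsideᵇ x S) * f (ins x S)))
           (sum-cong-≗ (graded S))) ⟩
    + (k !) * ∑ˢ n (λ S → sum λ x → 𝟙 (outsideᵇ x S) * fₖ (ins x S))
      ≡⟨ cong (+ (k !) *_) (∑ˢ-ins n fₖ) ⟩
    + (k !) * ∑ˢ n (λ T → + ∣ T ∣ * fₖ T)
      ≡⟨ cong (+ (k !) *_) (trans (∑ˢ-cong n cardinality) (∑ˢ-* n (+ suc k) fₖ)) ⟩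
    + (k !) * (+ suc k * ∑ˢ n fₖ)
      ≡⟨ trans (sym (*-assoc (+ (k !)) (+ suc k) (∑ˢ n fₖ)))
           (cong (_* ∑ˢ n fₖ) (trans (*-comm (+ (k !)) (+ suc k)) (sym (pos-* (suc k) (k !))))) ⟩
    + (suc k !) * ∑ˢ n fₖ ∎
    where
    open ≡-Reasoning
    f⁺ fₖ : Subset n → ℤ
    f⁺ S = sum λ x → 𝟙 (outsideᵇ x S) * f (ins x S)
    fₖ T = 𝟙 (∣ T ∣ ≡ᵇ suc k) * f T
    swap : ∀ a b c → a * b * c ≡ b * (a * c)
    swap = solve-∀
    graded : ∀ S x → 𝟙 (∣ S ∣ ≡ᵇ k) * (𝟙 (outsideᵇ x S) * f (ins x S)) ≡ 𝟙 (outsideᵇ x S) * fₖ (ins x S)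
    graded S x with outsideᵇ x S in x∉
    ... | true  rewrite ∣ins∣ x S x∉ = trans (cong (𝟙 (∣ S ∣ ≡ᵇ k) *_) (*-identityˡ (f (ins x S)))) (sym (*-identityˡ (𝟙 (∣ S ∣ ≡ᵇ k) * f (ins x S))))
    ... | false = trans (cong (𝟙 (∣ S ∣ ≡ᵇ k) *_) (*-zeroˡ (f (ins x S))))
                    (trans (*-zeroʳ (𝟙 (∣ S ∣ ≡ᵇ k))) (sym (*-zeroˡ (fₖ (ins x S)))))
    cardinality : ∀ T → + ∣ T ∣ * fₖ T ≡ + suc k * fₖ T
    cardinality T with ∣ T ∣ ≡ᵇ suc k in eq
    ... | true  = cong (λ m → + m * (1ℤ * f T)) (ℕₚ.≡ᵇ⇒≡ ∣ T ∣ (suc k) (subst Data.Bool.T (sym eq) _))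
    ... | false = trans (cong (+ ∣ T ∣ *_) (*-zeroˡ (f T))) (trans (*-zeroʳ (+ ∣ T ∣))
                    (sym (trans (cong (+ suc k *_) (*-zeroˡ (f T))) (*-zeroʳ (+ suc k)))))

  -- Sums over the j-subsets of a subset

  ∑⊆ : ∀ {n} → ℕ → Subset n → (Subset n → ℤ) → ℤ
  ∑⊆ zero    S           f = f ⊥
  ∑⊆ (suc j) []          f = 0ℤ
  ∑⊆ (suc j) (false ∷ S) f = ∑⊆ (suc j) S (f ∘ (false ∷_))
  ∑⊆ (suc j) (true ∷ S)  f = ∑⊆ (suc j) S (f ∘ (false ∷_)) + ∑⊆ j S (f ∘ (true ∷_))

  ∑⊆-⊥ : ∀ n j (f : Subset n → ℤ) → ∑⊆ (suc j) ⊥ f ≡ 0ℤ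
  ∑⊆-⊥ zero    j f = refl
  ∑⊆-⊥ (suc n) j f = ∑⊆-⊥ n j (f ∘ (false ∷_))

  ∑⊆-ins : ∀ {n} j (x : Fin n) S (f : Subset n → ℤ) → outsideᵇ x S ≡ true →
           ∑⊆ (suc j) (ins x S) f ≡ ∑⊆ (suc j) S f + ∑⊆ j S (f ∘ ins x)
  ∑⊆-ins zero    zero    (false ∷ S) f _  = refl
  ∑⊆-ins (suc j) zero    (false ∷ S) f _  = refl
  ∑⊆-ins zero    (suc x) (false ∷ S) f x∉ = ∑⊆-ins zero x S (f ∘ (false ∷_)) x∉
  ∑⊆-ins (suc j) (suc x) (false ∷ S) f x∉ = ∑⊆-ins (suc j) x S (f ∘ (false ∷_)) x∉
  ∑⊆-ins zero    (suc x) (true ∷ S)  f x∉ =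
    trans (cong (λ z → z + f (true ∷ ⊥)) (∑⊆-ins zero x S (f ∘ (false ∷_)) x∉))
      (rotate (∑⊆ 1 S (f ∘ (false ∷_))) (f (false ∷ ins x ⊥)) (f (true ∷ ⊥)))
    where
    rotate : ∀ a b c → a + b + c ≡ a + c + b
    rotate = solve-∀
  ∑⊆-ins (suc j) (suc x) (true ∷ S)  f x∉ =
    trans (cong₂ _+_ (∑⊆-ins (suc j) x S (f ∘ (false ∷_)) x∉) (∑⊆-ins j x S (f ∘ (true ∷_)) x∉))
      (interchange (∑⊆ (2 +ℕ j) S (f ∘ (false ∷_))) (∑⊆ (suc j) S (f ∘ (false ∷_) ∘ ins x))
                   (∑⊆ (suc j) S (f ∘ (true ∷_))) (∑⊆ j S (f ∘ (true ∷_) ∘ ins x)))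

  -- Mirrors the recursion of `∑⊆-ins` on a tuple, so that for a concrete length it unfolds to an
  -- explicit sum of values of `f`.
  ∑-combinations : ∀ {n k} → ℕ → Vec (Fin n) k → (Subset n → ℤ) → ℤ
  ∑-combinations zero    v       f = f ⊥
  ∑-combinations (suc j) []      f = 0ℤ
  ∑-combinations (suc j) (x ∷ v) f = ∑-combinations (suc j) v f + ∑-combinations j v (f ∘ ins x)

  ∑⊆-build : ∀ {n k} j (v : Vec (Fin n) k) f → distinct v ≡ true → ∑⊆ j (build v) f ≡ ∑-combinations j v f
  ∑⊆-build zero    v       f _ = refl
  ∑⊆-build (suc j) []      f _ = ∑⊆-⊥ _ j f
  ∑⊆-build (suc j) (x ∷ v) f d with outsideᵇ x (build v) in x∉
  ... | true = trans (∑⊆-ins j x (build v) f x∉) (cong₂ _+_ (∑⊆-build (suc j) v f d) (∑⊆-build j v (f ∘ ins x) d))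

  ∑ˢ-⊆ᵇ : ∀ {n} j (S : Subset n) (p : Subset n → Bool) →
          ∑ˢ n (λ T → 𝟙 (((∣ T ∣ ≡ᵇ j) ∧ p T) ∧ (T ⊆ᵇ S))) ≡ ∑⊆ j S (𝟙 ∘ p)
  ∑ˢ-⊆ᵇ zero    []          p with p []
  ... | true  = refl
  ... | false = refl
  ∑ˢ-⊆ᵇ {suc n} zero (b ∷ S)     p = trans (cong₂ _+_ (∑ˢ-⊆ᵇ zero S (p ∘ (false ∷_))) (∑ˢ-0 n {λ _ → 0ℤ} λ _ → refl)) (+-identityʳ (𝟙 (p ⊥)))
  ∑ˢ-⊆ᵇ (suc j) []          p = refl
  ∑ˢ-⊆ᵇ (suc j) (false ∷ S) p = trans
    (cong₂ _+_ (∑ˢ-⊆ᵇ (suc j) S (p ∘ (false ∷_))) (∑ˢ-0 _ λ T → cong 𝟙 (∧-zeroʳ ((∣ T ∣ ≡ᵇ j) ∧ p (true ∷ T))))) (+-identityʳ _)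
  ∑ˢ-⊆ᵇ (suc j) (true ∷ S)  p = cong₂ _+_ (∑ˢ-⊆ᵇ (suc j) S (p ∘ (false ∷_))) (∑ˢ-⊆ᵇ j S (p ∘ (true ∷_)))

  -- Five vertices

  -- With repeated arguments this reads `isEdge` on a set of fewer than three elements, where the
  -- value is arbitrary but still symmetric. The bound on sampled tuples holds for every symmetric
  -- `E`, so such values do no harm.
  edgeOf : ∀ {n} → ThreeGraph n → Fin n → Fin n → Fin n → Bool
  edgeOf G x y z = isEdge G (ins x (ins y (ins z ⊥)))

  edgeOf-swap₁₂ : ∀ {n} (G : ThreeGraph n) x y z → edgeOf G x y z ≡ edgeOf G y x z
  edgeOf-swap₁₂ G x y z = cong (isEdge G) (ins-comm x y (ins z ⊥))

  edgeOf-swap₂₃ : ∀ {n} (G : ThreeGraph n) x y z → edgeOf G x y z ≡ edgeOf G x z y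
  edgeOf-swap₂₃ G x y z = cong (isEdge G ∘ ins x) (ins-comm y z ⊥)

  count-∷ : ∀ b bs → + count (b ∷ bs) ≡ 𝟙 b + + count bs
  count-∷ true  bs = refl
  count-∷ false bs = sym (+-identityˡ _)

  ∑𝟙 : List Bool → ℤ
  ∑𝟙 []       = 0ℤ
  ∑𝟙 (b ∷ bs) = 𝟙 b + ∑𝟙 bs

  count-∑𝟙 : ∀ bs → + count bs ≡ ∑𝟙 bs
  count-∑𝟙 []       = refl
  count-∑𝟙 (b ∷ bs) = trans (count-∷ b bs) (cong (_+_ (𝟙 b)) (count-∑𝟙 bs))

  edgesIn-build : ∀ {n} (G : ThreeGraph n) (v : Vec (Fin n) 5) → distinct v ≡ true →
                  edgesIn G (build v) ≡ count (edges₅ (edgeOf G) v)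
  edgesIn-build {n} G v@(a ∷ b ∷ c ∷ d ∷ e ∷ []) dv = +-injective (begin
    # (λ T → edgeᵇ G T ∧ (T ⊆ᵇ build v)) (subsets n)  ≡⟨ #-subsets n _ ⟩
    ∑ˢ n (λ T → 𝟙 (edgeᵇ G T ∧ (T ⊆ᵇ build v)))       ≡⟨ ∑ˢ-⊆ᵇ 3 (build v) (isEdge G) ⟩
    ∑⊆ 3 (build v) (𝟙 ∘ isEdge G)                     ≡⟨ ∑⊆-build 3 v (𝟙 ∘ isEdge G) dv ⟩
    ∑-combinations 3 v (𝟙 ∘ isEdge G)
      ≡⟨ reorder (E a b c) (E a b d) (E a c d) (E b c d) (E a b e) (E a c e) (E b c e) (E a d e) (E b d e) (E c d e) ⟩
    ∑𝟙 (edges₅ (edgeOf G) v)                          ≡⟨ count-∑𝟙 (edges₅ (edgeOf G) v) ⟨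
    + count (edges₅ (edgeOf G) v)                     ∎)
    where
    open ≡-Reasoning
    E : Fin n → Fin n → Fin n → ℤ
    E x y z = 𝟙 (edgeOf G x y z)
    -- The left side is what `∑-combinations 3` unfolds to on five entries, with zeros from
    -- exhausted tails; the right side follows the order of `triples₅`.
    reorder : ∀ abc abd acd bcd abe ace bce ade bde cde →
      0ℤ + 0ℤ + (0ℤ + 0ℤ) + (0ℤ + 0ℤ + (0ℤ + cde)) + (0ℤ + 0ℤ + (0ℤ + bde) + (0ℤ + bce + bcd))
        + (0ℤ + 0ℤ + (0ℤ + ade) + (0ℤ + ace + acd) + (0ℤ + abe + abd + abc)) ≡
      abc + (abd + (acd + (bcd + (abe + (ace + (bce + (ade + (bde + (cde + 0ℤ)))))))))
    reorder = solve-∀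

  module _ {n : ℕ} (G : ThreeGraph n) (k : ℕ) where

    hasEdges : Vec (Fin n) 5 → Bool
    hasEdges v = count (edges₅ (edgeOf G) v) ≡ᵇ k

    ∑-distinct-e : ∑ᵛ 5 (λ v → 𝟙 (distinct v) * 𝟙 (hasEdges v)) ≡ + 120 * + e[ 5 ∙ k ] G
    ∑-distinct-e = begin
      ∑ᵛ 5 (λ v → 𝟙 (distinct v) * 𝟙 (hasEdges v))                   ≡⟨ ∑ᵛ-cong 5 (λ v → on-distinct v) ⟩
      ∑ᵛ 5 (λ v → 𝟙 (distinct v) * 𝟙 (edgesIn G (build v) ≡ᵇ k))     ≡⟨ ∑ᵛ-distinct 5 (λ S → 𝟙 (edgesIn G S ≡ᵇ k)) ⟩
      + 120 * ∑ˢ n (λ S → 𝟙 (∣ S ∣ ≡ᵇ 5) * 𝟙 (edgesIn G S ≡ᵇ k))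
        ≡⟨ cong (+ 120 *_) (trans (#-subsets n _) (∑ˢ-cong n λ S → 𝟙-∧ (∣ S ∣ ≡ᵇ 5) (edgesIn G S ≡ᵇ k))) ⟨
      + 120 * + e[ 5 ∙ k ] G                                         ∎
      where
      open ≡-Reasoning
      on-distinct : ∀ v → 𝟙 (distinct v) * 𝟙 (hasEdges v) ≡ 𝟙 (distinct v) * 𝟙 (edgesIn G (build v) ≡ᵇ k)
      on-distinct v with distinct v in dv
      ... | true  = cong (λ m → 1ℤ * 𝟙 (m ≡ᵇ k)) (sym (edgesIn-build G v dv))
      ... | false = trans (*-zeroˡ (𝟙 (hasEdges v))) (sym (*-zeroˡ (𝟙 (edgesIn G (build v) ≡ᵇ k))))

  ∑-distinct : ∀ n → ∑ᵛ {n} 5 (λ v → 𝟙 (distinct v)) ≡ + 120 * + (n C 5)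
  ∑-distinct n = begin
    ∑ᵛ {n} 5 (λ v → 𝟙 (distinct v))                ≡⟨ ∑ᵛ-cong {n} 5 (λ v → *-identityʳ (𝟙 (distinct v))) ⟨
    ∑ᵛ {n} 5 (λ v → 𝟙 (distinct v) * 1ℤ)           ≡⟨ ∑ᵛ-distinct {n} 5 (λ _ → 1ℤ) ⟩
    + 120 * ∑ˢ n (λ S → 𝟙 (∣ S ∣ ≡ᵇ 5) * 1ℤ)       ≡⟨ cong (+ 120 *_) (∑ˢ-cong n λ S → *-identityʳ (𝟙 (∣ S ∣ ≡ᵇ 5))) ⟩
    + 120 * ∑ˢ n (λ S → 𝟙 (∣ S ∣ ≡ᵇ 5))            ≡⟨ cong (+ 120 *_) (∑ˢ-binomial n 5) ⟩
    + 120 * + (n C 5)                              ∎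
    where open ≡-Reasoning

open SubsetSums

-- Complementation and the extremal bipartition

module Densities where

  open import Data.Bool using (Bool; true; false; not; _∧_; _∨_)
  open import Data.Bool.Properties using (∧-assoc; ∧-comm; ∧-idem; ∧-identityʳ; not-involutive)
  open import Data.Fin using (Fin; zero; suc)
  open import Data.Fin.Subset using (Subset; ⊥; ∁)
  open import Data.Integer using (ℤ; +_; 0ℤ; 1ℤ; _+_; _*_; _≤_; +≤+)
  open import Data.Integer.Properties using (+-comm; +-identityʳ; +-monoʳ-≤; +-mono-≤; *-zeroˡ; +-*-semiring; pos-*)
  open import Data.Integer.Solver using (module +-*-Solver)
  open import Data.Integer.Tactic.RingSolver using (solve-∀)
  open import Data.List using ([]; _∷_; map; length)
  open import Data.List.Properties using (map-cong; map-∘)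
  open import Data.Nat using (ℕ; zero; suc; _≡ᵇ_; ⌊_/2⌋; ⌈_/2⌉) renaming (_+_ to _+ℕ_; _^_ to _^ℕ_)
  import Data.Nat as ℕ
  import Data.Nat.Properties as ℕₚ
  open import Data.Product using (_,_)
  open import Data.Sum using (_⊎_; inj₁; inj₂)
  open import Data.Vec using (Vec; lookup; []; _∷_) renaming (map to mapᵛ)
  open import Data.Vec.Properties using (lookup-map)
  open import Function using (_∘_)
  open import Relation.Binary.PropositionalEquality
  open import Algebra.Properties.Semiring.Sum +-*-semiring using (sum; sum-cong-≗)

  -- Complementation

  count-not : ∀ bs → count bs +ℕ count (map not bs) ≡ length bs
  count-not []           = refl
  count-not (true ∷ bs)  = cong suc (count-not bs)
  count-not (false ∷ bs) = trans (ℕₚ.+-suc (count bs) _) (cong suc (count-not bs))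

  ≡ᵇ-complement : ∀ a b → a +ℕ b ≡ 10 → (a ≡ᵇ 9) ≡ (b ≡ᵇ 1)
  ≡ᵇ-complement 0  .10 refl = refl
  ≡ᵇ-complement 1  .9 refl = refl
  ≡ᵇ-complement 2  .8 refl = refl
  ≡ᵇ-complement 3  .7 refl = refl
  ≡ᵇ-complement 4  .6 refl = refl
  ≡ᵇ-complement 5  .5 refl = refl
  ≡ᵇ-complement 6  .4 refl = refl
  ≡ᵇ-complement 7  .3 refl = refl
  ≡ᵇ-complement 8  .2 refl = refl
  ≡ᵇ-complement 9  .1 refl = refl
  ≡ᵇ-complement 10 .0 refl = refl

  hasNine-complement : ∀ {n} (E E′ : Fin n → Fin n → Fin n → Bool) → (∀ x y z → E′ x y z ≡ not (E x y z)) →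
                       ∀ v → (count (edges₅ E v) ≡ᵇ 9) ≡ (count (edges₅ E′ v) ≡ᵇ 1)
  hasNine-complement E E′ E′≗not v = trans (≡ᵇ-complement (count bs) (count (map not bs)) (count-not bs))
    (cong (λ cs → count cs ≡ᵇ 1) (trans (sym (map-∘ {g = not} {f = Evaluation.edge E (lookup v)} triples₅)) (map-cong complement triples₅)))
    where
    bs = edges₅ E v
    complement : ∀ t → not (Evaluation.edge E (lookup v) t) ≡ Evaluation.edge E′ (lookup v) t
    complement (i , j , k) = sym (E′≗not (lookup v i) (lookup v j) (lookup v k))

  oneEdge-upper : ∀ {n} (G : ThreeGraph n) → + 8 * ∑ᵛ 5 (λ v → 𝟙 (hasEdges G 1 v)) ≤ + 5 * + (n ^ℕ 5)
  oneEdge-upper G = ∑oneEdge≤ (edgeOf G) (edgeOf-swap₁₂ G) (edgeOf-swap₂₃ G)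

  -- The one-edge bound holds for every symmetric `E`, in particular for the negation of `edgeOf G`;
  -- no complementary graph has to be built.
  nineEdges-upper : ∀ {n} (G : ThreeGraph n) → + 8 * ∑ᵛ 5 (λ v → 𝟙 (hasEdges G 9 v)) ≤ + 5 * + (n ^ℕ 5)
  nineEdges-upper {n} G = subst (λ x → + 8 * x ≤ + 5 * + (n ^ℕ 5))
    (sym (∑ᵛ-cong 5 λ v → cong 𝟙 (hasNine-complement (edgeOf G) E′ (λ _ _ _ → refl) v)))
    (∑oneEdge≤ E′ (λ x y z → cong not (edgeOf-swap₁₂ G x y z)) (λ x y z → cong not (edgeOf-swap₂₃ G x y z)))
    where
    E′ : Fin n → Fin n → Fin n → Bool
    E′ x y z = not (edgeOf G x y z)

  -- The balanced bipartition

  -- Alternating colours yield parts of sizes ⌈n/2⌉ and ⌊n/2⌋ by plain recursion on `n`.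
  alternating : Bool → ∀ n → Subset n
  alternating b zero    = []
  alternating b (suc n) = b ∷ alternating (not b) n

  ∑-alternating : ∀ b n (g : Bool → ℤ) →
                  sum (λ i → g (lookup (alternating b n) i)) ≡ + ⌈ n /2⌉ * g b + + ⌊ n /2⌋ * g (not b)
  ∑-alternating b zero    g = sym (cong₂ _+_ (*-zeroˡ (g b)) (*-zeroˡ (g (not b))))
  ∑-alternating b (suc n) g = begin
    g b + sum (λ i → g (lookup (alternating (not b) n) i))
      ≡⟨ cong (_+_ (g b)) (∑-alternating (not b) n g) ⟩
    g b + (+ ⌈ n /2⌉ * g (not b) + + ⌊ n /2⌋ * g (not (not b)))
      ≡⟨ cong (λ c → g b + (+ ⌈ n /2⌉ * g (not b) + + ⌊ n /2⌋ * g c)) (not-involutive b) ⟩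
    g b + (+ ⌈ n /2⌉ * g (not b) + + ⌊ n /2⌋ * g b)
      ≡⟨ eq (g b) (g (not b)) (+ ⌈ n /2⌉) (+ ⌊ n /2⌋) ⟩
    + suc ⌊ n /2⌋ * g b + + ⌈ n /2⌉ * g (not b) ∎
    where
    open ≡-Reasoning
    eq : ∀ x y p q → x + (p * y + q * x) ≡ (1ℤ + q) * x + p * y
    eq = solve-∀

  ∑-colourings : ℤ → ℤ → ∀ k → (Vec Bool k → ℤ) → ℤ
  ∑-colourings p q zero    h = h []
  ∑-colourings p q (suc k) h = p * ∑-colourings p q k (h ∘ (true ∷_)) + q * ∑-colourings p q k (h ∘ (false ∷_))

  ∑ᵛ-colour : ∀ n k (h : Vec Bool k → ℤ) → ∑ᵛ k (λ v → h (mapᵛ (lookup (alternating true n)) v))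
                                         ≡ ∑-colourings (+ ⌈ n /2⌉) (+ ⌊ n /2⌋) k h
  ∑ᵛ-colour n zero    h = refl
  ∑ᵛ-colour n (suc k) h = trans (sum-cong-≗ λ i → ∑ᵛ-colour n k (h ∘ (lookup (alternating true n) i ∷_)))
    (∑-alternating true n λ b → ∑-colourings (+ ⌈ n /2⌉) (+ ⌊ n /2⌋) k (h ∘ (b ∷_)))

  monochromatic : Bool → Bool → Bool → Bool
  monochromatic a b c = (a ∧ b ∧ c) ∨ (not a ∧ not b ∧ not c)

  threeTwo : Vec Bool 5 → ℤ
  threeTwo c = 𝟙 (count (map (λ (i , j , k) → monochromatic (lookup c i) (lookup c j) (lookup c k)) triples₅) ≡ᵇ 1)

  -- Splits 5+0, 4+1 and 3+2 have 10, 4 and 1 monochromatic triples, so only 3+2 counts, giving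
  -- 10p³q² + 10p²q³. `symbolic` repeats `∑-colourings` in the syntax of the solver, with the 32
  -- values of `threeTwo` computed.
  ∑-threeTwo : ∀ p q → ∑-colourings p q 5 threeTwo ≡ + 10 * (p * p * (q * q) * (p + q))
  ∑-threeTwo = solve 2 (λ p q → symbolic p q 5 threeTwo := con (+ 10) :* (p :* p :* (q :* q) :* (p :+ q))) refl
    where
    open +-*-Solver
    symbolic : ∀ {m} → Polynomial m → Polynomial m → ∀ k → (Vec Bool k → ℤ) → Polynomial m
    symbolic p q zero    h = con (h [])
    symbolic p q (suc k) h = p :* symbolic p q k (h ∘ (true ∷_)) :+ q :* symbolic p q k (h ∘ (false ∷_))

  ⌈n/2⌉-cases : ∀ n → ⌈ n /2⌉ ≡ ⌊ n /2⌋ ⊎ ⌈ n /2⌉ ≡ suc ⌊ n /2⌋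
  ⌈n/2⌉-cases zero          = inj₁ refl
  ⌈n/2⌉-cases (suc zero)    = inj₂ refl
  ⌈n/2⌉-cases (suc (suc n)) with ⌈n/2⌉-cases n
  ... | inj₁ eq = inj₁ (cong suc eq)
  ... | inj₂ eq = inj₂ (cong suc eq)

  infixr 8 _^ℤ_
  _^ℤ_ : ℤ → ℕ → ℤ
  x ^ℤ zero  = 1ℤ
  x ^ℤ suc k = x * x ^ℤ k

  pos-^ : ∀ n k → + (n ^ℕ k) ≡ (+ n) ^ℤ k
  pos-^ n zero    = refl
  pos-^ n (suc k) = trans (pos-* n (n ^ℕ k)) (cong (+ n *_) (pos-^ n k))

  balanced : ∀ n → + 5 * + (n ^ℕ 5) ≤
             + 8 * (+ 10 * (+ ⌈ n /2⌉ * + ⌈ n /2⌉ * (+ ⌊ n /2⌋ * + ⌊ n /2⌋) * (+ ⌈ n /2⌉ + + ⌊ n /2⌋))) + + 10 * + (n ^ℕ 4)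
  balanced n = subst₂ (λ x y → + 5 * x ≤ + 8 * (+ 10 * (+ p * + p * (+ q * + q) * (+ p + + q))) + + 10 * y)
    (sym (pos-^ n 5)) (sym (pos-^ n 4)) (go p q (+ n) (⌈n/2⌉-cases n) (cong +_ (sym (trans (ℕₚ.+-comm p q) (ℕₚ.⌊n/2⌋+⌈n/2⌉≡n n)))))
    where
    p = ⌈ n /2⌉
    q = ⌊ n /2⌋
    even : ∀ x → let m = x + x in
      + 5 * (m * (m * (m * (m * (m * 1ℤ))))) + + 10 * (m * m * (m * m)) ≡
      + 8 * (+ 10 * (x * x * (x * x) * m)) + + 10 * (m * (m * (m * (m * 1ℤ))))
    even = solve-∀
    -- For even n the main terms agree exactly. Here 4x(x + 1) = m² - 1, so the main term is 5m(m² -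
    -- 1)², and with the allowance 10m⁴ the slack is 10m⁴ - 10m³ + 5m = 20xm³ + 5m.
    odd : ∀ x → let m = 1ℤ + x + x in
      + 5 * (m * (m * (m * (m * (m * 1ℤ))))) + (+ 20 * x * (m * m) * m + + 5 * m) ≡
      + 8 * (+ 10 * ((1ℤ + x) * (1ℤ + x) * (x * x) * m)) + + 10 * (m * (m * (m * (m * 1ℤ))))
    odd = solve-∀
    increase : ∀ {a b c} → 0ℤ ≤ b → a + b ≡ c → a ≤ c
    increase {a} 0≤b a+b≡c = subst₂ _≤_ (+-identityʳ a) a+b≡c (+-monoʳ-≤ a 0≤b)
    go : ∀ p q m → p ≡ q ⊎ p ≡ suc q → m ≡ + p + + q →
         + 5 * m ^ℤ 5 ≤ + 8 * (+ 10 * (+ p * + p * (+ q * + q) * (+ p + + q))) + + 10 * m ^ℤ 4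
    go p .p       m (inj₁ refl) refl = increase (0≤i*j {+ 10} (+≤+ ℕ.z≤n) (0≤i*i (m * m))) (even (+ p))
    go .(suc q) q m (inj₂ refl) refl = increase (+-mono-≤ (0≤i*j (0≤i*j (0≤i*j {+ 20} {+ q} (+≤+ ℕ.z≤n) (+≤+ ℕ.z≤n)) (0≤i*i m)) (+≤+ ℕ.z≤n))
      (0≤i*j {+ 5} {m} (+≤+ ℕ.z≤n) (+≤+ ℕ.z≤n))) (odd (+ q))

  colouring : ∀ n → Subset n
  colouring = alternating true

  ⊆ᵇ-ins : ∀ {n} (x : Fin n) T A → (ins x T ⊆ᵇ A) ≡ lookup A x ∧ (T ⊆ᵇ A)
  ⊆ᵇ-ins zero    (false ∷ T) (a ∷ A) = refl
  ⊆ᵇ-ins zero    (true ∷ T)  (a ∷ A) = trans (cong (_∧ (T ⊆ᵇ A)) (sym (∧-idem a))) (∧-assoc a a (T ⊆ᵇ A))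
  ⊆ᵇ-ins (suc x) (false ∷ T) (a ∷ A) = ⊆ᵇ-ins x T A
  ⊆ᵇ-ins (suc x) (true ∷ T)  (a ∷ A) = begin
    a ∧ (ins x T ⊆ᵇ A)             ≡⟨ cong (a ∧_) (⊆ᵇ-ins x T A) ⟩
    a ∧ (lookup A x ∧ (T ⊆ᵇ A))    ≡⟨ ∧-assoc a (lookup A x) (T ⊆ᵇ A) ⟨
    (a ∧ lookup A x) ∧ (T ⊆ᵇ A)    ≡⟨ cong (_∧ (T ⊆ᵇ A)) (∧-comm a (lookup A x)) ⟩
    (lookup A x ∧ a) ∧ (T ⊆ᵇ A)    ≡⟨ ∧-assoc (lookup A x) a (T ⊆ᵇ A) ⟩
    lookup A x ∧ (a ∧ (T ⊆ᵇ A))    ∎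
    where open ≡-Reasoning

  ⊥⊆ᵇ : ∀ {n} (A : Subset n) → (⊥ ⊆ᵇ A) ≡ true
  ⊥⊆ᵇ []      = refl
  ⊥⊆ᵇ (a ∷ A) = ⊥⊆ᵇ A

  triple⊆ᵇ : ∀ {n} (A : Subset n) x y z → (ins x (ins y (ins z ⊥)) ⊆ᵇ A) ≡ lookup A x ∧ lookup A y ∧ lookup A z
  triple⊆ᵇ A x y z = trans (⊆ᵇ-ins x (ins y (ins z ⊥)) A) (cong (lookup A x ∧_) (trans (⊆ᵇ-ins y (ins z ⊥) A) (cong (lookup A y ∧_)
    (trans (⊆ᵇ-ins z ⊥ A) (trans (cong (lookup A z ∧_) (⊥⊆ᵇ A)) (∧-identityʳ (lookup A z)))))))

  bipartition bipartitionᶜ : ∀ n → ThreeGraph n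
  bipartition  n = record { isEdge = λ T → (T ⊆ᵇ colouring n) ∨ (T ⊆ᵇ ∁ (colouring n)) }
  bipartitionᶜ n = record { isEdge = not ∘ isEdge (bipartition n) }

  -- Valid for repeated vertices too, because `isEdge` tests containment in a part for sets of any
  -- size. The sum over samples is thus exactly a polynomial in the two part sizes.
  edgeOf-bipartition : ∀ n x y z → let c = lookup (colouring n) in edgeOf (bipartition n) x y z ≡ monochromatic (c x) (c y) (c z)
  edgeOf-bipartition n x y z = cong₂ _∨_ (triple⊆ᵇ (colouring n) x y z)
    (trans (triple⊆ᵇ (∁ (colouring n)) x y z) (cong₂ _∧_ (lookup-map x not (colouring n))
      (cong₂ _∧_ (lookup-map y not (colouring n)) (lookup-map z not (colouring n)))))

  ∑-bipartition : ∀ n → ∑ᵛ 5 (λ v → 𝟙 (hasEdges (bipartition n) 1 v)) ≡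
    + 10 * (+ ⌈ n /2⌉ * + ⌈ n /2⌉ * (+ ⌊ n /2⌋ * + ⌊ n /2⌋) * (+ ⌈ n /2⌉ + + ⌊ n /2⌋))
  ∑-bipartition n = trans (∑ᵛ-cong 5 λ v → cong (λ bs → 𝟙 (count bs ≡ᵇ 1)) (map-cong (λ (i , j , k) →
      trans (edgeOf-bipartition n (lookup v i) (lookup v j) (lookup v k)) (colours v i j k)) triples₅))
    (trans (∑ᵛ-colour n 5 threeTwo) (∑-threeTwo (+ ⌈ n /2⌉) (+ ⌊ n /2⌋)))
    where
    c = lookup (colouring n)
    colours : ∀ v i j k → monochromatic (c (lookup v i)) (c (lookup v j)) (c (lookup v k)) ≡
              monochromatic (lookup (mapᵛ c v) i) (lookup (mapᵛ c v) j) (lookup (mapᵛ c v) k)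
    colours v i j k rewrite lookup-map i c v | lookup-map j c v | lookup-map k c v = refl

  oneEdge-lower : ∀ n → + 5 * + (n ^ℕ 5) ≤ + 8 * ∑ᵛ 5 (λ v → 𝟙 (hasEdges (bipartition n) 1 v)) + + 10 * + (n ^ℕ 4)
  oneEdge-lower n = subst (λ x → + 5 * + (n ^ℕ 5) ≤ + 8 * x + + 10 * + (n ^ℕ 4)) (sym (∑-bipartition n)) (balanced n)

  nineEdges-lower : ∀ n → + 5 * + (n ^ℕ 5) ≤ + 8 * ∑ᵛ 5 (λ v → 𝟙 (hasEdges (bipartitionᶜ n) 9 v)) + + 10 * + (n ^ℕ 4)
  nineEdges-lower n = subst (λ x → + 5 * + (n ^ℕ 5) ≤ + 8 * x + + 10 * + (n ^ℕ 4))
    (sym (∑ᵛ-cong 5 λ v → cong 𝟙 (hasNine-complement (edgeOf (bipartitionᶜ n)) (edgeOf (bipartition n))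
      (λ x y z → sym (not-involutive (edgeOf (bipartition n) x y z))) v))) (oneEdge-lower n)

open Densities

-- Repeated vertices as a lower-order error

module Estimates where

  open import Data.Integer using (_+_; _*_; _≤_; ℤ; +_; 0ℤ; 1ℤ)
  open import Data.Integer.Properties
    using (≤-trans; +-mono-≤; *-monoˡ-≤-nonNeg; *-cancelˡ-≤-pos; +-monoʳ-≤;
           +-monoˡ-≤; *-monoʳ-≤-nonNeg; module ≤-Reasoning)
  open import Data.Bool using (true; false)
  import Data.Integer as ℤ
  import Data.Integer.Properties as ℤ
  open import Data.Integer.Tactic.RingSolver using (solve-∀)
  open import Data.Nat using (ℕ; zero; suc)
  import Data.Nat as ℕ
  import Data.Nat.Properties as ℕₚ
  import Data.Nat.DivMod as ℕ
  import Data.Nat.Tactic.RingSolver as ℕSolver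
  open import Data.Nat.Combinatorics using (_C_; nCk≡nPk/k!)
  open import Data.Nat.Combinatorics.Base using (_P′_)
  open import Data.Nat.Combinatorics.Specification using (k!∣nP′k)
  open import Data.Product using (_,_)
  open import Relation.Binary.PropositionalEquality

  -- Writing n as 4 + m makes the falling factorial a product without truncated subtraction. At m =
  -- 0 both sides vanish; the quotient formula for binomials applies from 5 on.
  120*nC5 : ∀ m → 120 ℕ.* ((4 ℕ.+ m) C 5) ≡ (4 ℕ.+ m) P′ 5
  120*nC5 zero    = refl
  120*nC5 (suc m) = begin
    120 ℕ.* ((5 ℕ.+ m) C 5)                ≡⟨ cong (120 ℕ.*_) (nCk≡nPk/k! {5} {5 ℕ.+ m} 5≤5+m) ⟩
    120 ℕ.* (((5 ℕ.+ m) P′ 5) ℕ./ 120)     ≡⟨ ℕ.m*[n/m]≡n {120} (k!∣nP′k 5≤5+m) ⟩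
    (5 ℕ.+ m) P′ 5                         ∎
    where
    open ≡-Reasoning
    5≤5+m : 5 ℕ.≤ 5 ℕ.+ m
    5≤5+m = ℕₚ.m≤m+n 5 m

  +-cancelʳ-≤ : ∀ k i j → i + k ≤ j + k → i ≤ j
  +-cancelʳ-≤ k i j le = subst₂ _≤_ (eq i k) (eq j k) (+-monoˡ-≤ (ℤ.- k) le)
    where
    eq : ∀ i k → i + k + ℤ.- k ≡ i
    eq = solve-∀

  pow5≤ : ∀ n → 4 ℕ.≤ n → + (n ℕ.^ 5) ≤ + 120 * + (n C 5) + + 10 * + (n ℕ.^ 4)
  pow5≤ n 4≤n with m , refl ← ℕₚ.m≤n⇒∃[o]m+o≡n 4≤n = subst (+ ((4 ℕ.+ m) ℕ.^ 5) ≤_) cast (ℤ.+≤+ le)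
    where
    cast : + (120 ℕ.* ((4 ℕ.+ m) C 5) ℕ.+ 10 ℕ.* (4 ℕ.+ m) ℕ.^ 4) ≡ + 120 * + ((4 ℕ.+ m) C 5) + + 10 * + ((4 ℕ.+ m) ℕ.^ 4)
    cast = trans (ℤ.pos-+ (120 ℕ.* ((4 ℕ.+ m) C 5)) (10 ℕ.* (4 ℕ.+ m) ℕ.^ 4)) (cong₂ _+_ (ℤ.pos-* 120 ((4 ℕ.+ m) C 5)) (ℤ.pos-* 10 ((4 ℕ.+ m) ℕ.^ 4)))
    -- The coefficient 10 is 1 + 2 + 3 + 4. The remainder is 35x³ - 50x² + 24x, whose coefficients
    -- in m are all positive once x = 4 + m.
    expansion : ∀ m → let x = 4 ℕ.+ m in
      x ℕ.* (x ℕ.* (x ℕ.* (x ℕ.* (x ℕ.* 1)))) ℕ.+ (35 ℕ.* (m ℕ.* (m ℕ.* m)) ℕ.+ 370 ℕ.* (m ℕ.* m) ℕ.+ 1304 ℕ.* m ℕ.+ 1536) ≡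
      m ℕ.* ((1 ℕ.+ m) ℕ.* ((2 ℕ.+ m) ℕ.* ((3 ℕ.+ m) ℕ.* (x ℕ.* 1)))) ℕ.+ 10 ℕ.* (x ℕ.* (x ℕ.* (x ℕ.* (x ℕ.* 1))))
    expansion = ℕSolver.solve-∀
    le : (4 ℕ.+ m) ℕ.^ 5 ℕ.≤ 120 ℕ.* ((4 ℕ.+ m) C 5) ℕ.+ 10 ℕ.* (4 ℕ.+ m) ℕ.^ 4
    le = subst ((4 ℕ.+ m) ℕ.^ 5 ℕ.≤_) (trans (expansion m) (cong (ℕ._+ 10 ℕ.* (4 ℕ.+ m) ℕ.^ 4) (sym (120*nC5 m)))) (ℕₚ.m≤m+n _ _)

  -- The 10 absorbs the error 10n⁴ of `pow5≤`, which leaves 7Mn⁴ ≤ 120 (n choose 5); the 7 is the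
  -- least integer with 8 · 7 ≥ 50.
  threshold : ℕ → ℕ
  threshold M = 10 ℕ.+ 7 ℕ.* M

  pow4≤ : ∀ M n → threshold M ℕ.≤ n → + M * (+ 50 * + (n ℕ.^ 4)) ≤ + 8 * (+ 120 * + (n C 5))
  pow4≤ M n N≤n = begin
    + M * (+ 50 * x)        ≤⟨ *-monoˡ-≤-nonNeg (+ M) (*-monoʳ-≤-nonNeg x {+ 50} {+ 56} (ℤ.+≤+ (ℕₚ.m≤m+n 50 6))) ⟩
    + M * (+ 56 * x)        ≡⟨ eq₁ (+ M) x ⟩
    + 8 * (+ 7 * + M * x)   ≤⟨ *-monoˡ-≤-nonNeg (+ 8) step ⟩
    + 8 * (+ 120 * + (n C 5)) ∎
    where
    open ≤-Reasoning
    x = + (n ℕ.^ 4)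
    eq₁ : ∀ m x → m * (+ 56 * x) ≡ + 8 * (+ 7 * m * x)
    eq₁ = solve-∀
    eq₂ : ∀ m x → (+ 10 + + 7 * m) * x ≡ + 7 * m * x + + 10 * x
    eq₂ = solve-∀
    step : + 7 * + M * x ≤ + 120 * + (n C 5)
    step = +-cancelʳ-≤ (+ 10 * x) _ _ (begin
      + 7 * + M * x + + 10 * x              ≡⟨ eq₂ (+ M) x ⟨
      (+ 10 + + 7 * + M) * x                ≡⟨ cong (λ z → (+ 10 + z) * x) (ℤ.pos-* 7 M) ⟨
      + threshold M * x                     ≤⟨ *-monoʳ-≤-nonNeg x (ℤ.+≤+ N≤n) ⟩
      + n * x                               ≡⟨ ℤ.pos-* n (n ℕ.^ 4) ⟨
      + (n ℕ.^ 5)                           ≤⟨ pow5≤ n (ℕₚ.≤-trans (ℕₚ.m≤m+n 4 (6 ℕ.+ 7 ℕ.* M)) N≤n) ⟩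
      + 120 * + (n C 5) + + 10 * x          ∎)

  -- Since 5M + 8 = 8M(5/8 + 1/M), this is the upper bound for ε = 1/M with denominators cleared.
  -- The term 50x is 5 times the error 10x from repeated vertices.
  upper-combine : ∀ M e c x y → + 8 * (+ 120 * e) ≤ + 5 * y → y ≤ + 120 * c + + 10 * x →
                  + M * (+ 50 * x) ≤ + 8 * (+ 120 * c) → + M * (+ 8 * e) ≤ (+ 5 * + M + + 8) * c
  upper-combine M e c x y h₁ h₂ h₃ = *-cancelˡ-≤-pos _ _ (+ 120) (begin
    + 120 * (+ M * (+ 8 * e))                          ≡⟨ eq₁ (+ M) e ⟩
    + M * (+ 8 * (+ 120 * e))                          ≤⟨ *-monoˡ-≤-nonNeg (+ M) (≤-trans h₁ (*-monoˡ-≤-nonNeg (+ 5) h₂)) ⟩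
    + M * (+ 5 * (+ 120 * c + + 10 * x))               ≡⟨ eq₂ (+ M) c x ⟩
    + 5 * + M * (+ 120 * c) + + M * (+ 50 * x)         ≤⟨ +-monoʳ-≤ (+ 5 * + M * (+ 120 * c)) h₃ ⟩
    + 5 * + M * (+ 120 * c) + + 8 * (+ 120 * c)        ≡⟨ eq₃ (+ M) c ⟩
    + 120 * ((+ 5 * + M + + 8) * c)                    ∎)
    where
    open ≤-Reasoning
    eq₁ : ∀ m e → + 120 * (m * (+ 8 * e)) ≡ m * (+ 8 * (+ 120 * e))
    eq₁ = solve-∀
    eq₂ : ∀ m c x → m * (+ 5 * (+ 120 * c + + 10 * x)) ≡ + 5 * m * (+ 120 * c) + m * (+ 50 * x)
    eq₂ = solve-∀
    eq₃ : ∀ m c → + 5 * m * (+ 120 * c) + + 8 * (+ 120 * c) ≡ + 120 * ((+ 5 * m + + 8) * c)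
    eq₃ = solve-∀

  lower-combine : ∀ M e c x y s → s + + 120 * c ≤ + 120 * e + y → + 5 * y ≤ + 8 * s + + 10 * x → y ≤ + 120 * c + + 10 * x →
                  0ℤ ≤ x → + M * (+ 50 * x) ≤ + 8 * (+ 120 * c) → + 5 * + M * c ≤ + M * (+ 8 * e) + + 8 * c
  lower-combine M e c x y s h₁ h₂ h₃ 0≤x h₄ = *-cancelˡ-≤-pos _ _ (+ 120) (begin
    + 120 * (+ 5 * + M * c)                                ≡⟨ eq₁ (+ M) c ⟩
    + M * (+ 5 * (+ 120 * c))                              ≤⟨ *-monoˡ-≤-nonNeg (+ M) combined ⟩
    + M * (+ 8 * (+ 120 * e) + + 40 * x)                   ≤⟨ *-monoˡ-≤-nonNeg (+ M) (+-monoʳ-≤ (+ 8 * (+ 120 * e)) forty≤fifty) ⟩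
    + M * (+ 8 * (+ 120 * e) + + 50 * x)                   ≡⟨ eq₂ (+ M) e x ⟩
    + 120 * (+ M * (+ 8 * e)) + + M * (+ 50 * x)           ≤⟨ +-monoʳ-≤ (+ 120 * (+ M * (+ 8 * e))) h₄ ⟩
    + 120 * (+ M * (+ 8 * e)) + + 8 * (+ 120 * c)          ≡⟨ eq₃ (+ M) e c ⟩
    + 120 * (+ M * (+ 8 * e) + + 8 * c)                    ∎)
    where
    open ≤-Reasoning
    eq₁ : ∀ m c → + 120 * (+ 5 * m * c) ≡ m * (+ 5 * (+ 120 * c))
    eq₁ = solve-∀
    eq₂ : ∀ m e x → m * (+ 8 * (+ 120 * e) + + 50 * x) ≡ + 120 * (m * (+ 8 * e)) + m * (+ 50 * x)
    eq₂ = solve-∀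
    eq₃ : ∀ m e c → + 120 * (m * (+ 8 * e)) + + 8 * (+ 120 * c) ≡ + 120 * (m * (+ 8 * e) + + 8 * c)
    eq₃ = solve-∀
    forty≤fifty : + 40 * x ≤ + 50 * x
    forty≤fifty = *-monoʳ-≤-nonNeg x {{ℤ.nonNegative 0≤x}} {+ 40} {+ 50} (ℤ.+≤+ (ℕₚ.m≤m+n 40 10))
    eq₄ : ∀ c y s → + 5 * (+ 120 * c) + (+ 8 * s + + 8 * y + + 3 * (+ 120 * c)) ≡ + 8 * (s + + 120 * c) + (+ 5 * y + + 3 * y)
    eq₄ = solve-∀
    eq₅ : ∀ e c x y s → + 8 * (+ 120 * e + y) + (+ 8 * s + + 10 * x + + 3 * (+ 120 * c + + 10 * x)) ≡
                        + 8 * (+ 120 * e) + + 40 * x + (+ 8 * s + + 8 * y + + 3 * (+ 120 * c))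
    eq₅ = solve-∀
    -- `h₁` gives 8 · 120e ≥ 8s + 8 · 120c - 8y, then `h₂` replaces 8s by 5y - 10x, and `h₃` bounds
    -- the remaining -3y. The error is 10x + 3 · 10x = 40x.
    combined : + 5 * (+ 120 * c) ≤ + 8 * (+ 120 * e) + + 40 * x
    combined = +-cancelʳ-≤ (+ 8 * s + + 8 * y + + 3 * (+ 120 * c)) _ _ (subst₂ _≤_ (sym (eq₄ c y s)) (eq₅ e c x y s)
      (+-mono-≤ (*-monoˡ-≤-nonNeg (+ 8) h₁) (+-mono-≤ h₂ (*-monoˡ-≤-nonNeg (+ 3) h₃))))

  module _ {n : ℕ} (G : ThreeGraph n) (k : ℕ) where

    sampled : ℤ
    sampled = ∑ᵛ 5 λ v → 𝟙 (hasEdges G k v)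

    120e≤sampled : + 120 * + e[ 5 ∙ k ] G ≤ sampled
    120e≤sampled = subst (_≤ sampled) (∑-distinct-e G k) (∑ᵛ-mono 5 λ v → drop (distinct v) (hasEdges G k v))
      where
      drop : ∀ a b → 𝟙 a * 𝟙 b ≤ 𝟙 b
      drop true  b     = ℤ.≤-reflexive (ℤ.*-identityˡ (𝟙 b))
      drop false true  = ℤ.+≤+ ℕ.z≤n
      drop false false = ℤ.≤-refl

    -- Exactly n⁵ − 120 (n choose 5) of the sampled tuples repeat a vertex.
    sampled≤120e : sampled + + 120 * + (n C 5) ≤ + 120 * + e[ 5 ∙ k ] G + + (n ℕ.^ 5)
    sampled≤120e = begin
      sampled + + 120 * + (n C 5)                                       ≡⟨ cong (_+_ sampled) (∑-distinct n) ⟨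
      sampled + ∑ᵛ {n} 5 (λ v → 𝟙 (distinct v))                            ≡⟨ ∑ᵛ-+ {n} 5 (λ v → 𝟙 (hasEdges G k v)) (λ v → 𝟙 (distinct v)) ⟨
      ∑ᵛ 5 (λ v → 𝟙 (hasEdges G k v) + 𝟙 (distinct v))                 ≤⟨ ∑ᵛ-mono 5 (λ v → add (distinct v) (hasEdges G k v)) ⟩
      ∑ᵛ 5 (λ v → 𝟙 (distinct v) * 𝟙 (hasEdges G k v) + 1ℤ)            ≡⟨ ∑ᵛ-+ 5 (λ v → 𝟙 (distinct v) * 𝟙 (hasEdges G k v)) (λ _ → 1ℤ) ⟩
      ∑ᵛ 5 (λ v → 𝟙 (distinct v) * 𝟙 (hasEdges G k v)) + ∑ᵛ {n} 5 (λ _ → 1ℤ)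
        ≡⟨ cong₂ _+_ (∑-distinct-e G k) (trans (∑ᵛ-const {n} 5 1ℤ) (ℤ.*-identityʳ (+ (n ℕ.^ 5)))) ⟩
      + 120 * + e[ 5 ∙ k ] G + + (n ℕ.^ 5)                              ∎
      where
      open ≤-Reasoning
      add : ∀ a b → 𝟙 b + 𝟙 a ≤ 𝟙 a * 𝟙 b + 1ℤ
      add true  true  = ℤ.≤-refl
      add true  false = ℤ.≤-refl
      add false true  = ℤ.≤-refl
      add false false = ℤ.+≤+ ℕ.z≤n

  module _ (M : ℕ) {n : ℕ} (N≤n : threshold M ℕ.≤ n) (G : ThreeGraph n) (k : ℕ) where

    4≤n : 4 ℕ.≤ n
    4≤n = ℕₚ.≤-trans (ℕₚ.m≤m+n 4 (6 ℕ.+ 7 ℕ.* M)) N≤n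

    upper-e : + 8 * sampled G k ≤ + 5 * + (n ℕ.^ 5) → + M * (+ 8 * + e[ 5 ∙ k ] G) ≤ (+ 5 * + M + + 8) * + (n C 5)
    upper-e h = upper-combine M (+ e[ 5 ∙ k ] G) (+ (n C 5)) (+ (n ℕ.^ 4)) (+ (n ℕ.^ 5))
      (≤-trans (*-monoˡ-≤-nonNeg (+ 8) (120e≤sampled G k)) h) (pow5≤ n 4≤n) (pow4≤ M n N≤n)

    lower-e : + 5 * + (n ℕ.^ 5) ≤ + 8 * sampled G k + + 10 * + (n ℕ.^ 4) →
              + 5 * + M * + (n C 5) ≤ + M * (+ 8 * + e[ 5 ∙ k ] G) + + 8 * + (n C 5)
    lower-e h = lower-combine M (+ e[ 5 ∙ k ] G) (+ (n C 5)) (+ (n ℕ.^ 4)) (+ (n ℕ.^ 5)) (sampled G k)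
      (sampled≤120e G k) h (pow5≤ n 4≤n) (ℤ.+≤+ ℕ.z≤n) (pow4≤ M n N≤n)

open Estimates

-- Passage to rational ε

import Data.Integer as ℤ
import Data.Integer.Properties as ℤ
open import Data.Integer.Tactic.RingSolver using (solve-∀)
open import Data.Nat.Coprimality using (Coprime)
import Data.Nat as ℕ
import Data.Rational.Properties as ℚ
import Data.Rational.Unnormalised as ℚᵘ
import Data.Rational.Unnormalised.Properties as ℚᵘ
open import Data.Rational using (mkℚ; toℚᵘ; *<*; ℚ; _/_; _+_; _-_; _*_; _≤_; _<_; 0ℚ)
open import Data.Rational.Unnormalised using (mkℚᵘ; *≤*)
open import Relation.Binary.PropositionalEquality
open import Data.Product using (_,_; Σ; _×_)
open import Data.Nat using (ℕ; suc; _≥_)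
open import Data.Nat.Combinatorics using (_C_)
open import Data.Integer using (+_)

toℚᵘ-integer : ∀ m → toℚᵘ (+ m / 1) ℚᵘ.≃ mkℚᵘ (+ m) 0
toℚᵘ-integer m = ℚ.toℚᵘ-fromℚᵘ (mkℚᵘ (+ m) 0)

toℚᵘ-bound : ∀ δ C → toℚᵘ ((+ 5 / 8 + δ) * (+ C / 1)) ℚᵘ.≃ (mkℚᵘ (+ 5) 7 ℚᵘ.+ toℚᵘ δ) ℚᵘ.* mkℚᵘ (+ C) 0
toℚᵘ-bound δ C = ℚᵘ.≃-trans (ℚ.toℚᵘ-homo-* (+ 5 / 8 + δ) (+ C / 1))
  (ℚᵘ.*-cong (ℚ.toℚᵘ-homo-+ (+ 5 / 8) δ) (toℚᵘ-integer C))

module _ (a d : ℕ) .{cop : Coprime (suc a) (suc d)} (e C : ℕ) where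
  private
    ε = mkℚ (+ suc a) d cop
    M = suc d

  -- This is the excess of ε = (a + 1)/M over 1/M, times C and the common denominator 8M; it turns
  -- the bounds for 1/M into bounds for ε.
  0≤8aC : ℤ.0ℤ ℤ.≤ + 8 ℤ.* (+ a ℤ.* + C)
  0≤8aC = subst (ℤ.0ℤ ℤ.≤_) (trans (ℤ.pos-* 8 (a ℕ.* C)) (cong (+ 8 ℤ.*_) (ℤ.pos-* a C))) (ℤ.+≤+ ℕ.z≤n)

  ≤5/8+ε : + M ℤ.* (+ 8 ℤ.* + e) ℤ.≤ (+ 5 ℤ.* + M ℤ.+ + 8) ℤ.* + C → (+ e / 1) ≤ (+ 5 / 8 + ε) * (+ C / 1)
  ≤5/8+ε h = ℚ.toℚᵘ-cancel-≤ (begin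
    toℚᵘ (+ e / 1)                                                        ≃⟨ toℚᵘ-integer e ⟩
    mkℚᵘ (+ e) 0                                                          ≤⟨ *≤* cross ⟩
    (mkℚᵘ (+ 5) 7 ℚᵘ.+ mkℚᵘ (+ suc a) d) ℚᵘ.* mkℚᵘ (+ C) 0                ≃⟨ toℚᵘ-bound ε C ⟨
    toℚᵘ ((+ 5 / 8 + ε) * (+ C / 1))                                      ∎)
    where
    open ℚᵘ.≤-Reasoning
    eq₁ : ∀ e m → m ℤ.* (+ 8 ℤ.* e) ≡ e ℤ.* (+ 8 ℤ.* m ℤ.* + 1)
    eq₁ = solve-∀
    eq₂ : ∀ c m x → (+ 5 ℤ.* m ℤ.+ + 8) ℤ.* c ℤ.+ + 8 ℤ.* (x ℤ.* c) ≡ (+ 5 ℤ.* m ℤ.+ (+ 1 ℤ.+ x) ℤ.* + 8) ℤ.* c ℤ.* + 1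
    eq₂ = solve-∀
    cross : + e ℤ.* (+ 8 ℤ.* + M ℤ.* + 1) ℤ.≤ (+ 5 ℤ.* + M ℤ.+ + suc a ℤ.* + 8) ℤ.* + C ℤ.* + 1
    cross = subst₂ ℤ._≤_ (eq₁ (+ e) (+ M)) (eq₂ (+ C) (+ M) (+ a))
      (subst (ℤ._≤ _) (ℤ.+-identityʳ _) (ℤ.+-mono-≤ h 0≤8aC))

  5/8-ε≤ : + 5 ℤ.* + M ℤ.* + C ℤ.≤ + M ℤ.* (+ 8 ℤ.* + e) ℤ.+ + 8 ℤ.* + C → (+ 5 / 8 - ε) * (+ C / 1) ≤ (+ e / 1)
  5/8-ε≤ h = ℚ.toℚᵘ-cancel-≤ (begin
    toℚᵘ ((+ 5 / 8 - ε) * (+ C / 1))                                      ≃⟨ toℚᵘ-bound (Data.Rational.- ε) C ⟩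
    (mkℚᵘ (+ 5) 7 ℚᵘ.+ mkℚᵘ (ℤ.- + suc a) d) ℚᵘ.* mkℚᵘ (+ C) 0            ≤⟨ *≤* cross ⟩
    mkℚᵘ (+ e) 0                                                          ≃⟨ toℚᵘ-integer e ⟨
    toℚᵘ (+ e / 1)                                                        ∎)
    where
    open ℚᵘ.≤-Reasoning
    eq₁ : ∀ c m x → + 5 ℤ.* m ℤ.* c ℤ.+ ℤ.- (+ 8 ℤ.* c ℤ.+ + 8 ℤ.* (x ℤ.* c)) ≡ (+ 5 ℤ.* m ℤ.+ ℤ.- (+ 1 ℤ.+ x) ℤ.* + 8) ℤ.* c ℤ.* + 1
    eq₁ = solve-∀
    eq₂ : ∀ c e m → m ℤ.* (+ 8 ℤ.* e) ℤ.+ + 8 ℤ.* c ℤ.+ ℤ.- (+ 8 ℤ.* c) ≡ e ℤ.* (+ 8 ℤ.* m ℤ.* + 1)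
    eq₂ = solve-∀
    weaken : ℤ.- (+ 8 ℤ.* + C ℤ.+ + 8 ℤ.* (+ a ℤ.* + C)) ℤ.≤ ℤ.- (+ 8 ℤ.* + C)
    weaken = ℤ.neg-mono-≤ (ℤ.≤-trans (ℤ.≤-reflexive (sym (ℤ.+-identityʳ (+ 8 ℤ.* + C)))) (ℤ.+-monoʳ-≤ (+ 8 ℤ.* + C) 0≤8aC))
    cross : (+ 5 ℤ.* + M ℤ.+ ℤ.- + suc a ℤ.* + 8) ℤ.* + C ℤ.* + 1 ℤ.≤ + e ℤ.* (+ 8 ℤ.* + M ℤ.* + 1)
    cross = subst₂ ℤ._≤_ (eq₁ (+ C) (+ M) (+ a)) (eq₂ (+ C) (+ e) (+ M)) (ℤ.+-mono-≤ h weaken)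

limit-5/8 : ∀ k →
  (∀ {n} (G : ThreeGraph n) → + 8 ℤ.* sampled G k ℤ.≤ + 5 ℤ.* + (n ℕ.^ 5)) →
  (H : ∀ n → ThreeGraph n) → (∀ n → + 5 ℤ.* + (n ℕ.^ 5) ℤ.≤ + 8 ℤ.* sampled (H n) k ℤ.+ + 10 ℤ.* + (n ℕ.^ 4)) →
  (ε : ℚ) → 0ℚ < ε → Σ ℕ λ N → (n : ℕ) → n ≥ N →
  ((G : ThreeGraph n) → (+ e[ 5 ∙ k ] G / 1) ≤ ((+ 5 / 8) + ε) * (+ (n C 5) / 1))
  × (Σ (ThreeGraph n) λ G → ((+ 5 / 8) - ε) * (+ (n C 5) / 1) ≤ (+ e[ 5 ∙ k ] G / 1))
-- A positive ε with denominator d + 1 is at least 1/(d + 1), so a threshold depending on the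
-- denominator alone suffices.
limit-5/8 k upper H lower (mkℚ (+ suc a) d cop) _ = threshold (suc d) , λ n N≤n →
  (λ G → ≤5/8+ε a d {cop} (e[ 5 ∙ k ] G) (n C 5) (upper-e (suc d) N≤n G k (upper G))) ,
  H n , 5/8-ε≤ a d {cop} (e[ 5 ∙ k ] (H n)) (n C 5) (lower-e (suc d) N≤n (H n) k (lower n))
limit-5/8 k upper H lower (mkℚ (+ 0) d cop)        (*<* (ℤ.+<+ ()))
limit-5/8 k upper H lower (mkℚ (ℤ.-[1+ _ ]) d cop) (*<* ())

theorem2p31 :
    ((ε : ℚ) → 0ℚ < ε → Σ ℕ λ N → (n : ℕ) → n ≥ N →
      ((G : ThreeGraph n) → (+ e[ 5 ∙ 1 ] G / 1) ≤ ((+ 5 / 8) + ε) * (+ (n C 5) / 1))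
      × (Σ (ThreeGraph n) λ G → ((+ 5 / 8) - ε) * (+ (n C 5) / 1) ≤ (+ e[ 5 ∙ 1 ] G / 1)))
    ×
    ((ε : ℚ) → 0ℚ < ε → Σ ℕ λ N → (n : ℕ) → n ≥ N →
      ((G : ThreeGraph n) → (+ e[ 5 ∙ 9 ] G / 1) ≤ ((+ 5 / 8) + ε) * (+ (n C 5) / 1))
      × (Σ (ThreeGraph n) λ G → ((+ 5 / 8) - ε) * (+ (n C 5) / 1) ≤ (+ e[ 5 ∙ 9 ] G / 1)))
theorem2p31 = limit-5/8 1 oneEdge-upper bipartition oneEdge-lower , limit-5/8 9 nineEdges-upper bipartitionᶜ nineEdges-lower
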